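{- On arbitrary finite structures, $\mathsf{SO}\text{ - }\mathsf{HORN}^r$ has the same expressive power as $\mathsf{FO(LFP)}$: every $\mathsf{SO}\text{ - }\mathsf{HORN}^r$ sentence is equivalent on all finite structures to an $\mathsf{FO(LFP)}$ sentence, and vice versa.
   Context: $\mathsf{SO}\text{ - }\mathsf{HORN}^r(\sigma)$ (second-order revised Horn logic) is the set of second-order sentences of the form $Q_1R_1\cdots Q_mR_m\forall\bar x(C_1\wedge\dots\wedge C_n)$ with $Q_i\in\{\forall,\exists\}$, $R_1,\dots,R_m$ relation variables, and each $C_j$ an implication $\alpha_1\wedge\dots\wedge\alpha_l\wedge\beta_1\wedge\dots\wedge\beta_q\rightarrow H$ where each $\alpha_s$ is either an atom $R_i\bar x$ or a formula $\forall\bar z R_i\bar y\bar z$; each $\beta_t$ is an atom $P\bar y$ or its negation with $P\in\sigma$; and $H$ is an atom $R_k\bar u$ or $\bot$. $\mathsf{FO(LFP)}$ is first-order logic extended by the least fixed-point operator.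
   Formalization: Besides atoms Pȳ and their negations with P∈σ, the β's may also be equalities y=y' or inequalities y≠y'; without these, SO-HORN^r cannot express every FO(LFP) sentence (e.g. "some class of E is a singleton"). -}

module Defs where

open import Data.Nat using (ℕ; suc; _+_)
open import Data.Bool using (Bool; true; false; T)
open import Data.Fin using (Fin)
open import Data.Fin.Properties using ()
open import Data.Vec using (Vec; map; lookup; _++_) renaming ([] to []ᵥ; _∷_ to _∷ᵥ_)
open import Data.Sum using (_⊎_)
open import Data.List using (List; []; _∷_)
open import Data.List.Membership.Propositional using (_∈_)
open import Data.List.Relation.Unary.Any using (here; there; index)
open import Data.List.Relation.Unary.All as All using (All; []; _∷_)
open import Data.Product using (Σ; _×_; _,_)
open import Data.Unit using (⊤)
open import Data.Empty using (⊥)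
open import Relation.Nullary using (¬_)
open import Relation.Binary.PropositionalEquality using (_≡_; _≢_; refl)

-- A relational vocabulary σ: the list of arities of its relation symbols.
-- A relation symbol of arity k is a proof  k ∈ σ  (a position in the list).
Sig : Set
Sig = List ℕ

record Structure (σ : Sig) : Set where
  field
    size : ℕ
    rel  : ∀ {k} → k ∈ σ → Vec (Fin (suc size)) k → Bool

open Structure public

Univ : ∀ {σ} → Structure σ → Set
Univ A = Fin (suc (size A))

RelEnv : ∀ {σ} → Structure σ → List ℕ → Set
RelEnv A Δ = All (λ k → Vec (Univ A) k → Bool) Δ

-- Second-order variable contexts Δ: list of arities (de Bruijn, innermost first).
-- v : number of universally quantified first-order variables  x̄ .

data BodyLit (σ : Sig) (Δ : List ℕ) (v : ℕ) : Set where
  ratom : ∀ {k} → k ∈ Δ → Vec (Fin v) k → BodyLit σ Δ v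
  -- α : ∀ z̄ R_i ȳ z̄   (ȳ among x̄, z̄ = m fresh distinct variables)
  rall  : (j m : ℕ) → (j + m) ∈ Δ → Vec (Fin v) j → BodyLit σ Δ v
  -- β : P ȳ (true) or ¬ P ȳ (false), P ∈ σ
  patom : Bool → ∀ {k} → k ∈ σ → Vec (Fin v) k → BodyLit σ Δ v
  -- β : y = y' (true) or y ≠ y' (false)
  eatom : Bool → Fin v → Fin v → BodyLit σ Δ v

data Head (Δ : List ℕ) (v : ℕ) : Set where
  hrel : ∀ {k} → k ∈ Δ → Vec (Fin v) k → Head Δ v
  hbot : Head Δ v

record Clause (σ : Sig) (Δ : List ℕ) (v : ℕ) : Set where
  constructor _⇒_
  field
    body : List (BodyLit σ Δ v)
    head : Head Δ v

data SOHorn (σ : Sig) : List ℕ → Set where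
  matrix : ∀ {Δ} (v : ℕ) → List (Clause σ Δ v) → SOHorn σ Δ
  ∀R     : ∀ {Δ} (k : ℕ) → SOHorn σ (k ∷ Δ) → SOHorn σ Δ
  ∃R     : ∀ {Δ} (k : ℕ) → SOHorn σ (k ∷ Δ) → SOHorn σ Δ

SOHornSentence : Sig → Set
SOHornSentence σ = SOHorn σ []

signed : Bool → Set → Set
signed true  P = P
signed false P = ¬ P

module _ {σ : Sig} (A : Structure σ) where

  litSat : ∀ {Δ v} → RelEnv A Δ → Vec (Univ A) v → BodyLit σ Δ v → Set
  litSat ρ η (ratom i xs)    = T (All.lookup ρ i (map (lookup η) xs))
  litSat ρ η (rall j m i ys) =
    (zs : Vec (Univ A) m) → T (All.lookup ρ i (map (lookup η) ys ++ zs))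
  litSat ρ η (patom b p ys)  = signed b (T (rel A p (map (lookup η) ys)))
  litSat ρ η (eatom b y y')  = signed b (lookup η y ≡ lookup η y')

  headSat : ∀ {Δ v} → RelEnv A Δ → Vec (Univ A) v → Head Δ v → Set
  headSat ρ η (hrel i us) = T (All.lookup ρ i (map (lookup η) us))
  headSat ρ η hbot        = ⊥

  clauseSat : ∀ {Δ v} → RelEnv A Δ → Vec (Univ A) v → Clause σ Δ v → Set
  clauseSat ρ η (body ⇒ h) = All (litSat ρ η) body → headSat ρ η h

  soSat : ∀ {Δ} → RelEnv A Δ → SOHorn σ Δ → Set
  soSat ρ (matrix v cs) = (η : Vec (Univ A) v) → All (clauseSat ρ η) cs
  soSat ρ (∀R k φ) = (R : Vec (Univ A) k → Bool) → soSat (R ∷ ρ) φ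
  soSat ρ (∃R k φ) = Σ (Vec (Univ A) k → Bool) λ R → soSat (R ∷ ρ) φ

_⊨SO_ : ∀ {σ} → Structure σ → SOHornSentence σ → Set
A ⊨SO θ = soSat A [] θ

data FLFP (σ : Sig) (Δ : List ℕ) : ℕ → Set where
  ratm : ∀ {v k} → k ∈ σ → Vec (Fin v) k → FLFP σ Δ v
  eq   : ∀ {v} → Fin v → Fin v → FLFP σ Δ v
  rvar : ∀ {v k} → k ∈ Δ → Vec (Fin v) k → FLFP σ Δ v
  neg  : ∀ {v} → FLFP σ Δ v → FLFP σ Δ v
  and  : ∀ {v} → FLFP σ Δ v → FLFP σ Δ v → FLFP σ Δ v
  or   : ∀ {v} → FLFP σ Δ v → FLFP σ Δ v → FLFP σ Δ v
  all  : ∀ {v} → FLFP σ Δ (suc v) → FLFP σ Δ v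
  ex   : ∀ {v} → FLFP σ Δ (suc v) → FLFP σ Δ v
  -- [lfp_{R,x̄} φ](t̄): R new relation variable of arity k, x̄ the first k
  -- first-order variables of φ (the remaining v are parameters), t̄ : k terms
  lfp  : ∀ {v} (k : ℕ) → FLFP σ (k ∷ Δ) (k + v) → Vec (Fin v) k → FLFP σ Δ v

mutual
  Pos : ∀ {σ Δ v k} → k ∈ Δ → FLFP σ Δ v → Set
  Pos i (ratm p ts)    = ⊤
  Pos i (eq s t)      = ⊤
  Pos i (rvar j ts)   = ⊤
  Pos i (neg φ)       = Neg i φ
  Pos i (and φ ψ)     = Pos i φ × Pos i ψ
  Pos i (or φ ψ)      = Pos i φ × Pos i ψ
  Pos i (all φ)       = Pos i φ
  Pos i (ex φ)        = Pos i φ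
  Pos i (lfp k φ ts)  = Pos (there i) φ

  Neg : ∀ {σ Δ v k} → k ∈ Δ → FLFP σ Δ v → Set
  Neg i (ratm p ts)    = ⊤
  Neg i (eq s t)      = ⊤
  Neg i (rvar j ts)   = index i ≢ index j
  Neg i (neg φ)       = Pos i φ
  Neg i (and φ ψ)     = Neg i φ × Neg i ψ
  Neg i (or φ ψ)      = Neg i φ × Neg i ψ
  Neg i (all φ)       = Neg i φ
  Neg i (ex φ)        = Neg i φ
  Neg i (lfp k φ ts)  = Neg (there i) φ

WF : ∀ {σ Δ v} → FLFP σ Δ v → Set
WF (ratm p ts)   = ⊤
WF (eq s t)     = ⊤
WF (rvar j ts)  = ⊤
WF (neg φ)      = WF φ
WF (and φ ψ)    = WF φ × WF ψ
WF (or φ ψ)     = WF φ × WF ψ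
WF (all φ)      = WF φ
WF (ex φ)       = WF φ
WF (lfp k φ ts) = Pos (here refl) φ × WF φ

FOLFPSentence : Sig → Set
FOLFPSentence σ = Σ (FLFP σ [] 0) WF

module _ {σ : Sig} (A : Structure σ) where

  -- Semantics; the lfp case is the intersection of all prefixed points
  -- of the operator S ↦ {ā | A ⊨ φ(S, ā)}, which is its least fixed point
  -- when the operator is monotone (guaranteed by positivity).
  fSat : ∀ {Δ v} → RelEnv A Δ → Vec (Univ A) v → FLFP σ Δ v → Set
  fSat ρ η (ratm p ts)   = T (rel A p (map (lookup η) ts))
  fSat ρ η (eq s t)     = lookup η s ≡ lookup η t
  fSat ρ η (rvar i ts)  = T (All.lookup ρ i (map (lookup η) ts))
  fSat ρ η (neg φ)      = ¬ fSat ρ η φ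
  fSat ρ η (and φ ψ)    = fSat ρ η φ × fSat ρ η ψ
  fSat ρ η (or φ ψ)     = fSat ρ η φ ⊎ fSat ρ η ψ
  fSat ρ η (all φ)      = (a : Univ A) → fSat ρ (a ∷ᵥ η) φ
  fSat ρ η (ex φ)       = Σ (Univ A) λ a → fSat ρ (a ∷ᵥ η) φ
  fSat ρ η (lfp k φ ts) =
    (S : Vec (Univ A) k → Bool) →
    ((as : Vec (Univ A) k) → fSat (S ∷ ρ) (as ++ η) φ → T (S as)) →
    T (S (map (lookup η) ts))

_⊨LFP_ : ∀ {σ} → Structure σ → FOLFPSentence σ → Set
A ⊨LFP (φ , _) = fSat A [] []ᵥ φ

{-# OPTIONS --safe #-}
-- From SO-HORNʳ to FO(LFP), the relation quantifiers are eliminated from the inside, after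
-- generalizing Horn clauses to rules φ → R u and φ → ⊥ with φ positive in the relation
-- variables. For ∃R, the least R closed under the rules for R is optimal, and it is a least
-- fixed point that can be substituted for R. For ∀R, monotonicity reduces the rules with
-- another head to the full relation R, and a rule φ → R u to the complement of {u}.
--
-- From FO(LFP) to SO-HORNʳ, each subformula φ gets two relations, for φ and for ¬φ, defined
-- by Horn rules with the exact truth values as least solution; the prefix ∀z̄ R ȳ z̄ in rule
-- bodies handles quantifiers. Complements of least fixed points come from the stages: a tuple
-- y of the fixed point names the first stage containing it, and the stage of y together with
-- its complement yields the next one together with its complement, named by any of its new
-- elements. As the structure is finite, some stage is the last one, which can be verified by a
-- universal quantification, and its complement is the complement of the fixed point.
module Submission where

open import Defs
open import Data.Bool using (Bool; true; false; T; not; T?; _∨_)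
open import Data.Bool.Properties using (T-∨; T-≡)
open import Data.Empty using (⊥-elim)
open import Data.Fin using (Fin; zero; suc; _↑ˡ_; _↑ʳ_; funToFin; finToFun)
open import Data.Fin.Properties using (finToFun-funToFin; all?; any?) renaming (_≟_ to _≟ᶠ_)
open import Data.Fin.Subset using (Subset; ∣_∣) renaming (_∈_ to _∈ₛ_)
open import Data.Fin.Subset.Properties using (∣p∣≤n; p⊂q⇒∣p∣<∣q∣)
open import Data.List as List using (List; []; _∷_)
open import Data.List.Membership.Propositional using (_∈_)
open import Data.List.Relation.Unary.All as All using (All; []; _∷_)
open import Data.List.Relation.Unary.All.Properties using (++⁺; ++⁻; map⁺)
open import Data.List.Relation.Unary.Any using (here; there)
open import Data.Nat using (ℕ; zero; suc; _+_; _≤_; _<_; _≤?_; z≤n; s≤s; s≤s⁻¹; _^_)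
open import Data.Nat.Properties using (≤-trans; ≤-reflexive; m≤n+m; ≰⇒>; +-suc; +-identityʳ; +-monoˡ-≤; <⇒≱)
open import Data.Product using (Σ; _×_; _,_; proj₁; proj₂)
open import Data.Product.Function.NonDependent.Propositional using (_×-⇔_)
open import Data.Sum as Sum using (_⊎_; inj₁; inj₂)
open import Data.Sum.Function.Propositional using (_⊎-⇔_)
open import Data.Unit using (tt)
open import Data.Vec using (Vec; map; lookup; _++_; tabulate; allFin; replicate) renaming ([] to []ᵥ; _∷_ to _∷ᵥ_)
open import Data.Vec.Properties using (map-++; map-∘; map-cong; lookup-++ˡ; lookup-++ʳ; lookup-map; map-lookup-allFin; lookup-allFin; tabulate∘lookup; tabulate-cong; lookup∘tabulate; []=⇒lookup; lookup⇒[]=; ≡-dec; ∷-injective)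
open import Function using (_∘_; id)
open import Function.Bundles using (_⇔_; mk⇔; Equivalence)
open import Function.Construct.Composition using (_⇔-∘_)
open import Function.Construct.Identity using (⇔-id)
open import Function.Construct.Symmetry using (⇔-sym)
open import Function.Related.TypeIsomorphisms using (→-cong-⇔; ¬-cong-⇔)
open import Relation.Binary.PropositionalEquality using (_≡_; _≢_; refl; sym; trans; cong; cong₂; subst)
open import Relation.Nullary using (¬_; Dec; yes; no; ¬?)
open import Relation.Nullary.Decidable using (map′; _×-dec_; _⊎-dec_; _→-dec_; isYes; toWitness; fromWitness; decidable-stable)

open Equivalence using (to; from)

-- Stages of monotone operators on finite sets

-- The rules are chosen to be closed under both eliminations: substituting a positive formula, in
-- particular a least fixed point, into a positive body leaves it positive, and heads stay atomic.
-- ∀R commutes with the conjunction of rules, so each rule is treated alone; ∃R does not, so all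
-- rules with head R must be collected first. Once no relation variable is left, only refutations
-- remain, and the sentence is the negation of their disjunction. In the other direction, the
-- obstacle is that Horn rules with relational heads bound relations only from below. A formula can
-- be used negatively only if its negation is derived by rules of its own, and the single upper
-- bound is a last clause forbidding the negation of the whole sentence. Correctness splits
-- accordingly: the exact truth values satisfy all rules, and every model contains them. Without a
-- linear order, stages cannot be numbered; naming them by tuples leaves only the empty stage
-- without a name, hence its separate treatment.

module _ {n : ℕ} where

  encode : ∀ {k} → Vec (Fin n) k → Fin (n ^ k)
  encode = funToFin ∘ lookup

  decode : ∀ k → Fin (n ^ k) → Vec (Fin n) k
  decode k i = tabulate (finToFun {n} {k} i)

  decode-encode : ∀ {k} (xs : Vec (Fin n) k) → decode k (encode xs) ≡ xs
  decode-encode xs = trans (tabulate-cong (finToFun-funToFin (lookup xs))) (tabulate∘lookup xs)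

  all-vec? : ∀ {k} {P : Vec (Fin n) k → Set} → (∀ xs → Dec (P xs)) → Dec (∀ xs → P xs)
  all-vec? {k} {P} P? =
    map′ (λ h xs → subst P (decode-encode xs) (h (encode xs))) (λ h i → h (decode k i))
         (all? (P? ∘ decode k))

  any-vec? : ∀ {k} {P : Vec (Fin n) k → Set} → (∀ xs → Dec (P xs)) → Dec (Σ (Vec (Fin n) k) P)
  any-vec? {k} {P} P? =
    map′ (λ (i , p) → decode k i , p) (λ (xs , p) → encode xs , subst P (sym (decode-encode xs)) p)
         (any? (P? ∘ decode k))

-- Used twice on stages: for membership of a tuple it finds the step at which the tuple enters, and
-- for `Closed` the last step that adds anything.
switch : (P : ℕ → Set) → (∀ m → Dec (P m)) → ∀ N → P N → P 0 ⊎ Σ ℕ λ m → ¬ P m × P (suc m)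
switch P P? zero p = inj₁ p
switch P P? (suc N) p with P? N
... | yes q = switch P P? N q
... | no ¬q = inj₂ (N , ¬q , p)

-- The search is bounded: if none of `p 0`, ..., `p (N - 1)` holds, the value is `N`. Through
-- `level`, a tuple outside the fixed point therefore names the final stage.
rank : (ℕ → Bool) → ℕ → ℕ
rank p zero = zero
rank p (suc N) with p 0
... | true  = zero
... | false = suc (rank (p ∘ suc) N)

rank-first : ∀ p N m → m ≤ N → T (p m) → (∀ j → j < m → ¬ T (p j)) → rank p N ≡ m
rank-first p zero zero _ _ _ = refl
rank-first p (suc N) zero _ h _ with p 0
... | true = refl
rank-first p (suc N) (suc m) (s≤s m≤N) h least with p 0 in eq
... | true  = ⊥-elim (least 0 (s≤s z≤n) (from T-≡ eq))
... | false = cong suc (rank-first (p ∘ suc) N m m≤N h (λ j j<m → least (suc j) (s≤s j<m)))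

module Stages {n k : ℕ}
  (F : (Vec (Fin n) k → Bool) → Vec (Fin n) k → Bool)
  (F-mono : ∀ {S S'} → (∀ x → T (S x) → T (S' x)) → ∀ x → T (F S x) → T (F S' x)) where

  Rel : Set
  Rel = Vec (Fin n) k → Bool

  _⊑_ : Rel → Rel → Set
  S ⊑ S' = ∀ x → T (S x) → T (S' x)

  ⊑? : ∀ S S' → Dec (S ⊑ S')
  ⊑? S S' = all-vec? (λ x → T? (S x) →-dec T? (S' x))

  ⋢-witness : ∀ {S S'} → ¬ (S ⊑ S') → Σ _ λ x → T (S x) × ¬ T (S' x)
  ⋢-witness {S} {S'} h with any-vec? (λ x → T? (S x) ×-dec ¬? (T? (S' x)))
  ... | yes w = w
  ... | no ¬w = ⊥-elim (h λ x s → decidable-stable (T? (S' x)) (λ ¬s' → ¬w (x , s , ¬s')))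

  stage : ℕ → Rel
  stage zero    = λ _ → false
  stage (suc m) = F (stage m)

  stage-step : ∀ m → stage m ⊑ stage (suc m)
  stage-step zero    x ()
  stage-step (suc m) = F-mono (stage-step m)

  stage-inc : ∀ {m m'} → m ≤ m' → stage m ⊑ stage m'
  stage-inc {m' = zero}   z≤n x ()
  stage-inc {m' = suc m'} z≤n x ()
  stage-inc (s≤s m≤m') = F-mono (stage-inc m≤m')

  Closed : ℕ → Set
  Closed m = stage (suc m) ⊑ stage m

  closed? : ∀ m → Dec (Closed m)
  closed? m = ⊑? (stage (suc m)) (stage m)

  subset : Rel → Subset (n ^ k)
  subset S = tabulate (S ∘ decode k)

  abstract
    -- A stage that is not closed is followed by a strictly larger one, and no stage has more than
    -- `n ^ k` elements. In `go`, the fuel `f` and the cardinality reached always sum to more than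
    -- `n ^ k`, so the fuel cannot run out.
    closed-exists : Σ ℕ Closed
    closed-exists = go (suc (n ^ k)) 0 (m≤n+m _ _)
      where
      card : ℕ → ℕ
      card m = ∣ subset (stage m) ∣

      member : ∀ S x → T (S x) → encode x ∈ₛ subset S
      member S x s = lookup⇒[]= _ _
        (trans (lookup∘tabulate _ (encode x)) (to T-≡ (subst (T ∘ S) (sym (decode-encode x)) s)))

      unmember : ∀ S i → i ∈ₛ subset S → T (S (decode k i))
      unmember S i p = from T-≡ (trans (sym (lookup∘tabulate _ i)) ([]=⇒lookup p))

      grows : ∀ m → ¬ Closed m → card m < card (suc m)
      grows m ¬c with ⋢-witness ¬c
      ... | x , s , ¬s = p⊂q⇒∣p∣<∣q∣
        ( (λ {i} p → lookup⇒[]= i _ (trans (lookup∘tabulate _ i) (to T-≡ (stage-step m _ (unmember (stage m) i p)))))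
        , encode x , member (stage (suc m)) x s
        , λ p → ¬s (subst (T ∘ stage m) (decode-encode x) (unmember (stage m) _ p)))

      go : ∀ f m → n ^ k < card m + f → Σ ℕ Closed
      go zero m lt = ⊥-elim (<⇒≱ lt (≤-trans (≤-reflexive (+-identityʳ _)) (∣p∣≤n (subset (stage m)))))
      go (suc f) m lt with closed? m
      ... | yes c = m , c
      ... | no ¬c = go f (suc m) (≤-trans lt (≤-trans (≤-reflexive (+-suc _ f)) (+-monoˡ-≤ f (grows m ¬c))))

  N : ℕ
  N = proj₁ closed-exists

  closed-N : Closed N
  closed-N = proj₂ closed-exists

  Prefixed : Rel → Set
  Prefixed S = F S ⊑ S

  stage⊑prefixed : ∀ {S} → Prefixed S → ∀ m → stage m ⊑ S
  stage⊑prefixed p zero    x ()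
  stage⊑prefixed p (suc m) x s = p x (F-mono (stage⊑prefixed p m) x s)

  stage⊑N : ∀ m → stage m ⊑ stage N
  stage⊑N = stage⊑prefixed closed-N

  -- The closed stage is itself a prefixed point and lies below every other one. This replaces a
  -- quantification over all relations by a decidable membership.
  lfp⇔stage : ∀ t → (∀ S → Prefixed S → T (S t)) ⇔ T (stage N t)
  lfp⇔stage t = mk⇔ (λ h → h (stage N) closed-N) (λ s S p → stage⊑prefixed p N t s)

  level : Vec (Fin n) k → ℕ
  level y = rank (λ m → stage m y) N

  -- Stages increase, so absence from stage `m` excludes all earlier stages. This is why any new
  -- element can serve as a name of the stage it enters.
  level-new : ∀ m z → T (stage (suc m) z) → ¬ T (stage m z) → level z ≡ suc m
  level-new m z s ¬s = rank-first _ N (suc m) bound s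
    (λ { j (s≤s j≤m) t → ¬s (stage-inc j≤m z t) })
    where
    bound : suc m ≤ N
    -- If `N ≤ m`, stage `m` would contain the whole fixed point, hence `z`.
    bound with suc m ≤? N
    ... | yes p = p
    ... | no ¬p = ⊥-elim (¬s (stage-inc (s≤s⁻¹ (≰⇒> ¬p)) z (stage⊑N (suc m) z s)))

-- Monotonicity and decidability of FO(LFP)

-- For `U = Fin w` this renames a tuple of variables, so that evaluation and renaming share their
-- lemmas.
ev : ∀ {U : Set} {n k} → Vec U n → Vec (Fin n) k → Vec U k
ev η = map (lookup η)

shift : ∀ {v m} k → Vec (Fin v) m → Vec (Fin (k + v)) m
shift k = map (k ↑ʳ_)

extend : ∀ {k m} v → Vec (Fin k) m → Vec (Fin (k + v)) m
extend v = map (_↑ˡ v)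

firsts : ∀ k v → Vec (Fin (k + v)) k
firsts k v = extend v (allFin k)

module _ {U : Set} where

  ev-allFin : ∀ {v} (η : Vec U v) → ev η (allFin v) ≡ η
  ev-allFin = map-lookup-allFin

  ev-ev : ∀ {v w m} (η : Vec U w) (r : Vec (Fin w) v) (ts : Vec (Fin v) m) →
          ev η (ev r ts) ≡ ev (ev η r) ts
  ev-ev η r ts = trans (sym (map-∘ (lookup η) (lookup r) ts))
                       (map-cong (λ i → sym (lookup-map i (lookup η) r)) ts)

  ev-shift : ∀ {k v m} (xs : Vec U k) (η : Vec U v) (ts : Vec (Fin v) m) →
             ev (xs ++ η) (shift k ts) ≡ ev η ts
  ev-shift xs η ts = trans (sym (map-∘ _ _ ts)) (map-cong (lookup-++ʳ xs η) ts)

  ev-tail : ∀ {k v m} (η : Vec U (k + v)) (ts : Vec (Fin v) m) →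
            ev η (shift k ts) ≡ ev (ev η (shift k (allFin v))) ts
  ev-tail {k} {v} η ts = trans
    (cong (ev η) (map-cong (λ i → sym (trans (lookup-map i (k ↑ʳ_) (allFin v))
                                             (cong (k ↑ʳ_) (lookup-allFin i)))) ts))
    (ev-ev η (shift k (allFin v)) ts)

  ev-extend : ∀ {k v m} (xs : Vec U k) (η : Vec U v) (ts : Vec (Fin k) m) →
              ev (xs ++ η) (extend v ts) ≡ ev xs ts
  ev-extend xs η ts = trans (sym (map-∘ _ _ ts)) (map-cong (lookup-++ˡ xs η) ts)

  ev-firsts : ∀ {k v} (xs : Vec U k) (η : Vec U v) → ev (xs ++ η) (firsts k v) ≡ xs
  ev-firsts {k} xs η = trans (ev-extend xs η (allFin k)) (ev-allFin xs)

  ev-rests : ∀ {k v} (xs : Vec U k) (η : Vec U v) → ev (xs ++ η) (shift k (allFin v)) ≡ η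
  ev-rests {v = v} xs η = trans (ev-shift xs η (allFin v)) (ev-allFin η)

  ev-++ : ∀ {v m m' xs ys} (η : Vec U v) (X : Vec (Fin v) m) (Y : Vec (Fin v) m') →
          ev η X ≡ xs → ev η Y ≡ ys → ev η (X ++ Y) ≡ xs ++ ys
  ev-++ η X Y refl refl = map-++ (lookup η) X Y

  ev-++₃ : ∀ {v m m' m'' xs ys zs} (η : Vec U v)
           (X : Vec (Fin v) m) (Y : Vec (Fin v) m') (Z : Vec (Fin v) m'') →
           ev η X ≡ xs → ev η Y ≡ ys → ev η Z ≡ zs → ev η (X ++ (Y ++ Z)) ≡ xs ++ (ys ++ zs)
  ev-++₃ η X Y Z p q r = ev-++ η X (Y ++ Z) p (ev-++ η Y Z q r)

module _ {U : Set} where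

  infix 4 _⊆ᵣ_
  _⊆ᵣ_ : ∀ {k} → (Vec U k → Bool) → (Vec U k → Bool) → Set
  R ⊆ᵣ S = ∀ xs → T (R xs) → T (S xs)

  -- `Q` marks the variables that are allowed to grow strictly; at all others both environments
  -- agree. With `Q` the positivity in a formula, the relation bound by an inner `lfp` is simply one
  -- that does not change, and the induction passes under the binder.
  record Grows {Δ} (Q : ∀ {k} → k ∈ Δ → Set) (ρ ρ' : All (λ k → Vec U k → Bool) Δ) : Set where
    field
      ⊆-at : ∀ {k} (i : k ∈ Δ) → All.lookup ρ i ⊆ᵣ All.lookup ρ' i
      ⊇-at : ∀ {k} (i : k ∈ Δ) → Q i ⊎ All.lookup ρ' i ⊆ᵣ All.lookup ρ i

  open Grows

  grows-weaken : ∀ {Δ} {Q Q' : ∀ {k} → k ∈ Δ → Set} {ρ ρ'} →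
    (∀ {k} (i : k ∈ Δ) → Q i → Q' i) → Grows Q ρ ρ' → Grows Q' ρ ρ'
  grows-weaken f g .⊆-at i = g .⊆-at i
  grows-weaken f g .⊇-at i = Sum.map₁ (f i) (g .⊇-at i)

  grows-there : ∀ {Δ k} {Q : ∀ {m} → m ∈ (k ∷ Δ) → Set} {ρ ρ'} {S : Vec U k → Bool} →
    Grows (λ i → Q (there i)) ρ ρ' → Grows Q (S ∷ ρ) (S ∷ ρ')
  grows-there g .⊆-at (here refl) _ = id
  grows-there g .⊆-at (there i) = g .⊆-at i
  grows-there g .⊇-at (here refl) = inj₂ (λ _ → id)
  grows-there g .⊇-at (there i) = g .⊇-at i

  grows-here : ∀ {Δ k} {Q : ∀ {m} → m ∈ (k ∷ Δ) → Set} {ρ} {S S' : Vec U k → Bool} →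
    Q (here refl) → S ⊆ᵣ S' → Grows Q (S ∷ ρ) (S' ∷ ρ)
  grows-here q s .⊆-at (here refl) = s
  grows-here q s .⊆-at (there i) _ = id
  grows-here q s .⊇-at (here refl) = inj₁ q
  grows-here q s .⊇-at (there i) = inj₂ (λ _ → id)

open Grows

module _ {σ : Sig} (A : Structure σ) where

  mutual
    fSat-mono : ∀ {Δ v} (φ : FLFP σ Δ v) {ρ ρ' : RelEnv A Δ} {η} →
      Grows (λ i → Pos i φ) ρ ρ' → fSat A ρ η φ → fSat A ρ' η φ
    fSat-mono (ratm p ts) g h = h
    fSat-mono (eq s t) g h = h
    fSat-mono (rvar i ts) g h = g .⊆-at i _ h
    fSat-mono (neg φ) g h h' = h (fSat-anti φ g h')
    fSat-mono (and φ ψ) g (h , h') =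
      fSat-mono φ (grows-weaken (λ _ → proj₁) g) h , fSat-mono ψ (grows-weaken (λ _ → proj₂) g) h'
    fSat-mono (or φ ψ) g =
      Sum.map (fSat-mono φ (grows-weaken (λ _ → proj₁) g)) (fSat-mono ψ (grows-weaken (λ _ → proj₂) g))
    fSat-mono (all φ) g h a = fSat-mono φ g (h a)
    fSat-mono (ex φ) g (a , h) = a , fSat-mono φ g h
    fSat-mono (lfp k φ ts) g h S pre =
      h S (λ as p → pre as (fSat-mono φ (grows-there {Q = λ i → Pos i φ} g) p))

    fSat-anti : ∀ {Δ v} (φ : FLFP σ Δ v) {ρ ρ' : RelEnv A Δ} {η} →
      Grows (λ i → Neg i φ) ρ ρ' → fSat A ρ' η φ → fSat A ρ η φ
    fSat-anti (ratm p ts) g h = h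
    fSat-anti (eq s t) g h = h
    fSat-anti (rvar i ts) g h with g .⊇-at i
    -- `Neg` at the variable itself would say `index i ≢ index i`, so it is not among those that may
    -- grow.
    ... | inj₁ i≢i = ⊥-elim (i≢i refl)
    ... | inj₂ ⊇ = ⊇ _ h
    fSat-anti (neg φ) g h h' = h (fSat-mono φ g h')
    fSat-anti (and φ ψ) g (h , h') =
      fSat-anti φ (grows-weaken (λ _ → proj₁) g) h , fSat-anti ψ (grows-weaken (λ _ → proj₂) g) h'
    fSat-anti (or φ ψ) g =
      Sum.map (fSat-anti φ (grows-weaken (λ _ → proj₁) g)) (fSat-anti ψ (grows-weaken (λ _ → proj₂) g))
    fSat-anti (all φ) g h a = fSat-anti φ g (h a)
    fSat-anti (ex φ) g (a , h) = a , fSat-anti φ g h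
    fSat-anti (lfp k φ ts) g h S pre =
      h S (λ as p → pre as (fSat-anti φ (grows-there {Q = λ i → Neg i φ} g) p))

  -- Positivity makes the operator of every fixed point monotone, hence its
  -- finitely many stages decide it; without WF the lfp case would not follow.
  fSat? : ∀ {Δ v} (φ : FLFP σ Δ v) → WF φ → (ρ : RelEnv A Δ) → ∀ η → Dec (fSat A ρ η φ)

  step : ∀ {Δ v k} (φ : FLFP σ (k ∷ Δ) (k + v)) → WF φ → RelEnv A Δ → Vec (Univ A) v →
         (Vec (Univ A) k → Bool) → Vec (Univ A) k → Bool
  step φ w ρ η S xs = isYes (fSat? φ w (S ∷ ρ) (xs ++ η))

  step-mono : ∀ {Δ v k} (φ : FLFP σ (k ∷ Δ) (k + v)) (w : WF φ) (pos : Pos (here refl) φ)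
              (ρ : RelEnv A Δ) (η : Vec (Univ A) v) {S S'} →
              S ⊆ᵣ S' → step φ w ρ η S ⊆ᵣ step φ w ρ η S'
  step-mono φ w pos ρ η {S} {S'} S⊆S' xs h =
    fromWitness {a? = fSat? φ w (S' ∷ ρ) (xs ++ η)}
      (fSat-mono φ (grows-here {Q = λ i → Pos i φ} pos S⊆S')
        (toWitness {a? = fSat? φ w (S ∷ ρ) (xs ++ η)} h))

  fSat? (ratm p ts) w ρ η = T? _
  fSat? (eq s t) w ρ η = lookup η s ≟ᶠ lookup η t
  fSat? (rvar i ts) w ρ η = T? _
  fSat? (neg φ) w ρ η = ¬? (fSat? φ w ρ η)
  fSat? (and φ ψ) (w , w') ρ η = fSat? φ w ρ η ×-dec fSat? ψ w' ρ η
  fSat? (or φ ψ) (w , w') ρ η = fSat? φ w ρ η ⊎-dec fSat? ψ w' ρ η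
  fSat? (all φ) w ρ η = all? (λ a → fSat? φ w ρ (a ∷ᵥ η))
  fSat? (ex φ) w ρ η = any? (λ a → fSat? φ w ρ (a ∷ᵥ η))
  fSat? (lfp k φ ts) (pos , w) ρ η =
    map′ (λ s S pre → from (lfp⇔stage _) s S (λ x → pre x ∘ toWitness {a? = fSat? φ w (S ∷ ρ) (x ++ η)}))
         (λ h → to (lfp⇔stage _) (λ S pre → h S (λ x → pre x ∘ fromWitness {a? = fSat? φ w (S ∷ ρ) (x ++ η)})))
         (T? (stage N (ev η ts)))
    where open Stages (step φ w ρ η) (step-mono φ w pos ρ η)

-- From Horn sentences to fixed points

⇔-refl : ∀ {X : Set} → X ⇔ X
⇔-refl = ⇔-id _

≡⇒⇔ : ∀ {X Y : Set} → X ≡ Y → X ⇔ Y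
≡⇒⇔ refl = ⇔-refl

infixr 1 _⟫_
_⟫_ : ∀ {X Y Z : Set} → X ⇔ Y → Y ⇔ Z → X ⇔ Z
f ⟫ g = g ⇔-∘ f

Π-⇔ : ∀ {I : Set} {X Y : I → Set} → (∀ i → X i ⇔ Y i) → (∀ i → X i) ⇔ (∀ i → Y i)
Π-⇔ f = mk⇔ (λ h i → to (f i) (h i)) (λ h i → from (f i) (h i))

Σ-⇔ : ∀ {I : Set} {X Y : I → Set} → (∀ i → X i ⇔ Y i) → Σ I X ⇔ Σ I Y
Σ-⇔ f = mk⇔ (λ (i , h) → i , to (f i) h) (λ (i , h) → i , from (f i) h)

infix 4 _⊆ₗ_
_⊆ₗ_ : List ℕ → List ℕ → Set
Δ ⊆ₗ Γ = ∀ {k} → k ∈ Δ → k ∈ Γ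

under : ∀ {Δ Γ k} → Δ ⊆ₗ Γ → (k ∷ Δ) ⊆ₗ (k ∷ Γ)
under f (here p) = here p
under f (there i) = there (f i)

Preserves : ∀ {U : Set} {Δ Γ} → Δ ⊆ₗ Γ →
            All (λ k → Vec U k → Bool) Δ → All (λ k → Vec U k → Bool) Γ → Set
Preserves {Δ = Δ} f ρ ρ' = ∀ {k} (i : k ∈ Δ) → All.lookup ρ' (f i) ≡ All.lookup ρ i

under-preserves : ∀ {U : Set} {Δ Γ k} {f : Δ ⊆ₗ Γ} {ρ ρ'} {S : Vec U k → Bool} →
                  Preserves f ρ ρ' → Preserves (under f) (S ∷ ρ) (S ∷ ρ')
under-preserves e (here refl) = refl
under-preserves e (there i) = e i

lift : ∀ {v w} k → Vec (Fin w) v → Vec (Fin (k + w)) (k + v)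
lift {w = w} k r = firsts k w ++ shift k r

ev-lift : ∀ {U : Set} {v w k η} (xs : Vec U k) (η' : Vec U w) (r : Vec (Fin w) v) →
          ev η' r ≡ η → ev (xs ++ η') (lift k r) ≡ xs ++ η
ev-lift xs η' r e = ev-++ (xs ++ η') _ _ (ev-firsts xs η') (trans (ev-shift xs η' r) e)

-- Formulas positive in all relation variables; only atoms of σ and equalities are negated.
data PF (σ : Sig) (Δ : List ℕ) : ℕ → Set where
  patm : ∀ {v k} → Bool → k ∈ σ → Vec (Fin v) k → PF σ Δ v
  peq  : ∀ {v} → Bool → Fin v → Fin v → PF σ Δ v
  pvar : ∀ {v k} → k ∈ Δ → Vec (Fin v) k → PF σ Δ v
  pand : ∀ {v} → PF σ Δ v → PF σ Δ v → PF σ Δ v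
  por  : ∀ {v} → PF σ Δ v → PF σ Δ v → PF σ Δ v
  pall : ∀ {v} → PF σ Δ (suc v) → PF σ Δ v
  pex  : ∀ {v} → PF σ Δ (suc v) → PF σ Δ v
  plfp : ∀ {v} (k : ℕ) → PF σ (k ∷ Δ) (k + v) → Vec (Fin v) k → PF σ Δ v

module _ {σ : Sig} where

  emb : ∀ {Δ v} → PF σ Δ v → FLFP σ Δ v
  emb (patm true p ts)  = ratm p ts
  emb (patm false p ts) = neg (ratm p ts)
  emb (peq true s t)    = eq s t
  emb (peq false s t)   = neg (eq s t)
  emb (pvar i ts)       = rvar i ts
  emb (pand φ ψ)        = and (emb φ) (emb ψ)
  emb (por φ ψ)         = or (emb φ) (emb ψ)
  emb (pall φ)          = all (emb φ)
  emb (pex φ)           = ex (emb φ)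
  emb (plfp k φ ts)     = lfp k (emb φ) ts

  emb-Pos : ∀ {Δ v k} (i : k ∈ Δ) (φ : PF σ Δ v) → Pos i (emb φ)
  emb-Pos i (patm true p ts)  = tt
  emb-Pos i (patm false p ts) = tt
  emb-Pos i (peq true s t)    = tt
  emb-Pos i (peq false s t)   = tt
  emb-Pos i (pvar j ts)       = tt
  emb-Pos i (pand φ ψ)        = emb-Pos i φ , emb-Pos i ψ
  emb-Pos i (por φ ψ)         = emb-Pos i φ , emb-Pos i ψ
  emb-Pos i (pall φ)          = emb-Pos i φ
  emb-Pos i (pex φ)           = emb-Pos i φ
  emb-Pos i (plfp k φ ts)     = emb-Pos (there i) φ

  emb-WF : ∀ {Δ v} (φ : PF σ Δ v) → WF (emb φ)
  emb-WF (patm true p ts)  = tt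
  emb-WF (patm false p ts) = tt
  emb-WF (peq true s t)    = tt
  emb-WF (peq false s t)   = tt
  emb-WF (pvar j ts)       = tt
  emb-WF (pand φ ψ)        = emb-WF φ , emb-WF ψ
  emb-WF (por φ ψ)         = emb-WF φ , emb-WF ψ
  emb-WF (pall φ)          = emb-WF φ
  emb-WF (pex φ)           = emb-WF φ
  emb-WF (plfp k φ ts)     = emb-Pos (here refl) φ , emb-WF φ

  ren : ∀ {Δ Γ v w} → Δ ⊆ₗ Γ → Vec (Fin w) v → PF σ Δ v → PF σ Γ w
  ren f r (patm b p ts) = patm b p (ev r ts)
  ren f r (peq b s t)   = peq b (lookup r s) (lookup r t)
  ren f r (pvar i ts)   = pvar (f i) (ev r ts)
  ren f r (pand φ ψ)    = pand (ren f r φ) (ren f r ψ)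
  ren f r (por φ ψ)     = por (ren f r φ) (ren f r ψ)
  ren f r (pall φ)      = pall (ren f (lift 1 r) φ)
  ren f r (pex φ)       = pex (ren f (lift 1 r) φ)
  ren f r (plfp k φ ts) = plfp k (ren (under f) (lift k r) φ) (ev r ts)

  Sub : List ℕ → List ℕ → ℕ → Set
  Sub Δ Γ v = ∀ {k} → k ∈ Δ → PF σ Γ (k + v)

  wkSub : ∀ {Δ Γ Γ' v} m → Γ ⊆ₗ Γ' → Sub Δ Γ v → Sub Δ Γ' (m + v)
  wkSub {v = v} m f s {k} i = ren f (lift k (shift m (allFin v))) (s i)

  underSub : ∀ {Δ Γ v} k → Sub Δ Γ v → Sub (k ∷ Δ) (k ∷ Γ) (k + v)
  underSub k s (here refl) = pvar (here refl) (firsts k _)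
  underSub k s (there i)   = wkSub k there s i

  sub : ∀ {Δ Γ v} → Sub Δ Γ v → PF σ Δ v → PF σ Γ v
  sub s (patm b p ts) = patm b p ts
  sub s (peq b x y)   = peq b x y
  sub s (pvar i ts)   = ren id (ts ++ allFin _) (s i)
  sub s (pand φ ψ)    = pand (sub s φ) (sub s ψ)
  sub s (por φ ψ)     = por (sub s φ) (sub s ψ)
  sub s (pall φ)      = pall (sub (wkSub 1 id s) φ)
  sub s (pex φ)       = pex (sub (wkSub 1 id s) φ)
  sub s (plfp k φ ts) = plfp k (sub (underSub k s) φ) ts

  -- Truth is expressed by ∃x x = x, which relies on universes being nonempty.
  ptrue pfalse : ∀ {Δ v} → PF σ Δ v
  ptrue  = pex (peq true zero zero)
  pfalse = pex (peq false zero zero)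

  pallⁿ pexⁿ : ∀ {Δ v} m → PF σ Δ (m + v) → PF σ Δ v
  pallⁿ zero    φ = φ
  pallⁿ (suc m) φ = pallⁿ m (pall φ)
  pexⁿ zero    φ = φ
  pexⁿ (suc m) φ = pexⁿ m (pex φ)

  pequal pdiffer : ∀ {Δ v k} → Vec (Fin v) k → Vec (Fin v) k → PF σ Δ v
  pequal []ᵥ []ᵥ = ptrue
  pequal (x ∷ᵥ xs) (y ∷ᵥ ys) = pand (peq true x y) (pequal xs ys)
  pdiffer []ᵥ []ᵥ = pfalse
  pdiffer (x ∷ᵥ xs) (y ∷ᵥ ys) = por (peq false x y) (pdiffer xs ys)

  data Rule (Δ : List ℕ) : Set where
    derive : ∀ {k} → k ∈ Δ → PF σ Δ k → Rule Δ
    refute : PF σ Δ 0 → Rule Δ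

  literal : ∀ {Δ v} → BodyLit σ Δ v → PF σ Δ v
  literal (ratom i xs)    = pvar i xs
  literal (rall j m i ys) = pallⁿ m (pvar i (shift m ys ++ firsts m _))
  literal (patom b p ys)  = patm b p ys
  literal (eatom b y y')  = peq b y y'

  conjunction : ∀ {Δ v} → List (BodyLit σ Δ v) → PF σ Δ v
  conjunction [] = ptrue
  conjunction (l ∷ ls) = pand (literal l) (conjunction ls)

  -- Heads are normalized to distinct variables: R u becomes R x for a fresh tuple x, and the body
  -- becomes the existential closure of its conjunction with u = x.
  clauseRule : ∀ {Δ v} → Clause σ Δ v → Rule Δ
  clauseRule {v = v} (body ⇒ hrel {k} i us) = derive i (pexⁿ v
    (pand (ren id (firsts v k) (conjunction body)) (pequal (extend k us) (shift v (allFin k)))))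
  clauseRule {v = v} (body ⇒ hbot) = refute (pexⁿ v (ren id (firsts v 0) (conjunction body)))

  replace : ∀ {Δ v k} → PF σ Δ (k + v) → Sub (k ∷ Δ) Δ v
  replace φ (here refl) = φ
  replace φ (there i)   = pvar i (firsts _ _)

  module _ {k : ℕ} {Δ : List ℕ} where

    elim∀ : Rule (k ∷ Δ) → Rule Δ
    elim∀ (derive (here refl) φ) = refute (pexⁿ k (ren id (firsts k 0)
      (sub (replace (pdiffer (firsts k k) (shift k (allFin k)))) φ)))
    elim∀ (derive (there i) φ) = derive i (sub (replace ptrue) φ)
    elim∀ (refute φ)           = refute (sub (replace ptrue) φ)

    derivation : List (Rule (k ∷ Δ)) → PF σ (k ∷ Δ) k
    derivation [] = pfalse
    derivation (derive (here refl) φ ∷ rs) = por φ (derivation rs)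
    derivation (derive (there i) φ ∷ rs)   = derivation rs
    derivation (refute φ ∷ rs)             = derivation rs

    least : PF σ (k ∷ Δ) k → PF σ Δ k
    least φ = plfp k (ren id (firsts k k) φ) (allFin k)

    elim∃ : PF σ Δ k → Rule (k ∷ Δ) → Rule Δ
    -- The least fixed point satisfies the rules with head R automatically; a trivially true rule
    -- takes their place.
    elim∃ φ (derive (here refl) ψ) = refute pfalse
    elim∃ φ (derive (there i) ψ)   = derive i (sub (replace (ren id (firsts k _) φ)) ψ)
    elim∃ φ (refute ψ)             = refute (sub (replace (ren id (firsts k _) φ)) ψ)

  rules : ∀ {Δ} → SOHorn σ Δ → List (Rule Δ)
  rules (matrix v cs) = List.map clauseRule cs
  rules (∀R k θ) = List.map elim∀ (rules θ)
  rules (∃R k θ) = List.map (elim∃ (least (derivation (rules θ)))) (rules θ)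

  inconsistency : List (Rule []) → PF σ [] 0
  inconsistency [] = pfalse
  inconsistency (derive () φ ∷ rs)
  inconsistency (refute φ ∷ rs) = por φ (inconsistency rs)

-- Correctness of substitution and of the elimination of relation quantifiers

module _ {σ : Sig} (A : Structure σ) where

  pSat : ∀ {Δ v} → RelEnv A Δ → Vec (Univ A) v → PF σ Δ v → Set
  pSat ρ η φ = fSat A ρ η (emb φ)

  pSat? : ∀ {Δ v} (φ : PF σ Δ v) (ρ : RelEnv A Δ) η → Dec (pSat ρ η φ)
  pSat? φ = fSat? A (emb φ) (emb-WF φ)

  pSat-mono : ∀ {Δ v k} (φ : PF σ (k ∷ Δ) v) {ρ : RelEnv A Δ} {η S S'} →
              S ⊆ᵣ S' → pSat (S ∷ ρ) η φ → pSat (S' ∷ ρ) η φ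
  pSat-mono φ s = fSat-mono A (emb φ) (grows-here {Q = λ i → Pos i (emb φ)} (emb-Pos (here refl) φ) s)

  ren-sat : ∀ {Δ Γ v w} (φ : PF σ Δ v) {f : Δ ⊆ₗ Γ} {r : Vec (Fin w) v} {ρ ρ' η η'} →
            Preserves f ρ ρ' → ev η' r ≡ η → pSat ρ' η' (ren f r φ) ⇔ pSat ρ η φ
  ren-sat (patm true p ts) {r = r} {η' = η'} e refl =
    ≡⇒⇔ (cong (T ∘ rel A p) (ev-ev η' r ts))
  ren-sat (patm false p ts) {r = r} {η' = η'} e refl =
    ¬-cong-⇔ (≡⇒⇔ (cong (T ∘ rel A p) (ev-ev η' r ts)))
  ren-sat (peq true s t) {r = r} {η' = η'} e refl =
    ≡⇒⇔ (sym (cong₂ _≡_ (lookup-map s _ r) (lookup-map t _ r)))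
  ren-sat (peq false s t) {r = r} {η' = η'} e refl =
    ¬-cong-⇔ (≡⇒⇔ (sym (cong₂ _≡_ (lookup-map s _ r) (lookup-map t _ r))))
  ren-sat (pvar i ts) {r = r} {η' = η'} e refl =
    ≡⇒⇔ (cong₂ (λ R xs → T (R xs)) (e i) (ev-ev η' r ts))
  ren-sat (pand φ ψ) e q = ren-sat φ e q ×-⇔ ren-sat ψ e q
  ren-sat (por φ ψ) e q = ren-sat φ e q ⊎-⇔ ren-sat ψ e q
  ren-sat (pall φ) {r = r} {η' = η'} e q = Π-⇔ λ a → ren-sat φ e (ev-lift (a ∷ᵥ []ᵥ) η' r q)
  ren-sat (pex φ) {r = r} {η' = η'} e q = Σ-⇔ λ a → ren-sat φ e (ev-lift (a ∷ᵥ []ᵥ) η' r q)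
  ren-sat (plfp k φ ts) {f} {r} {η' = η'} e refl = Π-⇔ λ S →
    →-cong-⇔ (Π-⇔ λ as → →-cong-⇔ (ren-sat φ (under-preserves {f = f} e) (ev-lift as η' r refl)) ⇔-refl)
        (≡⇒⇔ (cong (T ∘ S) (ev-ev η' r ts)))

  record Interprets {Δ Γ v} (ρ : RelEnv A Γ) (η : Vec (Univ A) v) (s : Sub {σ} Δ Γ v)
                    (ρ* : RelEnv A Δ) : Set where
    constructor interprets
    field
      at : ∀ {k} (i : k ∈ Δ) us → pSat ρ (us ++ η) (s i) ⇔ T (All.lookup ρ* i us)

  open Interprets

  wkSub-interprets : ∀ {Δ Γ Γ' v m} {ρ ρ' η} {s : Sub Δ Γ v} {ρ*} {f : Γ ⊆ₗ Γ'} (xs : Vec (Univ A) m) →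
                     Preserves f ρ ρ' → Interprets ρ η s ρ* →
                     Interprets ρ' (xs ++ η) (wkSub m f s) ρ*
  wkSub-interprets {η = η} {s} xs e h .at i us =
    ren-sat (s i) e (ev-lift us (xs ++ η) _ (ev-rests xs η)) ⟫ h .at i us

  underSub-interprets : ∀ {Δ Γ v k} {ρ η} {s : Sub Δ Γ v} {ρ*} (S : Vec (Univ A) k → Bool) as →
                        Interprets ρ η s ρ* →
                        Interprets (S ∷ ρ) (as ++ η) (underSub k s) (S ∷ ρ*)
  underSub-interprets {η = η} S as h .at (here refl) us =
    ≡⇒⇔ (cong (T ∘ S) (ev-firsts us (as ++ η)))
  underSub-interprets {s = s} S as h .at (there i) us =
    wkSub-interprets {s = s} {f = there} as (λ _ → refl) h .at i us

  sub-sat : ∀ {Δ Γ v} (φ : PF σ Δ v) {s : Sub Δ Γ v} {ρ η ρ*} →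
            Interprets ρ η s ρ* → pSat ρ η (sub s φ) ⇔ pSat ρ* η φ
  sub-sat (patm true p ts) h = ⇔-refl
  sub-sat (patm false p ts) h = ⇔-refl
  sub-sat (peq true x y) h = ⇔-refl
  sub-sat (peq false x y) h = ⇔-refl
  sub-sat (pvar i ts) {s} {η = η} h =
    ren-sat (s i) (λ _ → refl) (ev-++ η ts _ refl (ev-allFin η)) ⟫ h .at i _
  sub-sat (pand φ ψ) h = sub-sat φ h ×-⇔ sub-sat ψ h
  sub-sat (por φ ψ) h = sub-sat φ h ⊎-⇔ sub-sat ψ h
  sub-sat (pall φ) {s} h = Π-⇔ λ a → sub-sat φ (wkSub-interprets {s = s} (a ∷ᵥ []ᵥ) (λ _ → refl) h)
  sub-sat (pex φ) {s} h = Σ-⇔ λ a → sub-sat φ (wkSub-interprets {s = s} (a ∷ᵥ []ᵥ) (λ _ → refl) h)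
  sub-sat (plfp k φ ts) h = Π-⇔ λ S →
    →-cong-⇔ (Π-⇔ λ as → →-cong-⇔ (sub-sat φ (underSub-interprets S as h)) ⇔-refl) ⇔-refl

  replace-interprets : ∀ {Δ v k} {φ : PF σ Δ (k + v)} {ρ η} {S : Vec (Univ A) k → Bool} →
    (∀ us → pSat ρ (us ++ η) φ ⇔ T (S us)) → Interprets ρ η (replace φ) (S ∷ ρ)
  replace-interprets h .at (here refl) us = h us
  replace-interprets {ρ = ρ} {η} h .at (there i) us = ≡⇒⇔ (cong (T ∘ All.lookup ρ i) (ev-firsts us η))

  pfalse-sat : ∀ {Δ v} {ρ : RelEnv A Δ} {η : Vec _ v} → ¬ pSat ρ η pfalse
  pfalse-sat (_ , h) = h refl

  uncons-Π : ∀ {U : Set} {m} {X : Vec U (suc m) → Set} →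
             (∀ as a → X (a ∷ᵥ as)) ⇔ (∀ as → X as)
  uncons-Π = mk⇔ (λ { h (a ∷ᵥ as) → h as a }) (λ h as a → h (a ∷ᵥ as))

  uncons-Σ : ∀ {U : Set} {m} {X : Vec U (suc m) → Set} →
             (Σ (Vec U m) λ as → Σ U λ a → X (a ∷ᵥ as)) ⇔ Σ (Vec U (suc m)) X
  uncons-Σ = mk⇔ (λ (as , a , h) → a ∷ᵥ as , h) (λ { (a ∷ᵥ as , h) → as , a , h })

  pallⁿ-sat : ∀ {Δ v} m (φ : PF σ Δ (m + v)) {ρ η} →
              pSat ρ η (pallⁿ m φ) ⇔ (∀ as → pSat ρ (as ++ η) φ)
  pallⁿ-sat zero φ = mk⇔ (λ { h []ᵥ → h }) (λ h → h []ᵥ)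
  pallⁿ-sat (suc m) φ = pallⁿ-sat m (pall φ) ⟫ uncons-Π

  pexⁿ-sat : ∀ {Δ v} m (φ : PF σ Δ (m + v)) {ρ η} →
             pSat ρ η (pexⁿ m φ) ⇔ (Σ (Vec (Univ A) m) λ as → pSat ρ (as ++ η) φ)
  pexⁿ-sat zero φ = mk⇔ (λ h → []ᵥ , h) (λ { ([]ᵥ , h) → h })
  pexⁿ-sat (suc m) φ = pexⁿ-sat m (pex φ) ⟫ uncons-Σ

  pequal-sat : ∀ {Δ v k} (xs ys : Vec (Fin v) k) {ρ : RelEnv A Δ} {η} →
               pSat ρ η (pequal xs ys) ⇔ (ev η xs ≡ ev η ys)
  pequal-sat []ᵥ []ᵥ = mk⇔ (λ _ → refl) (λ _ → zero , refl)
  pequal-sat (x ∷ᵥ xs) (y ∷ᵥ ys) = (⇔-refl ×-⇔ pequal-sat xs ys) ⟫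
    mk⇔ (λ (p , q) → cong₂ _∷ᵥ_ p q) ∷-injective

  pdiffer-sat : ∀ {Δ v k} (xs ys : Vec (Fin v) k) {ρ : RelEnv A Δ} {η} →
                pSat ρ η (pdiffer xs ys) ⇔ (ev η xs ≢ ev η ys)
  pdiffer-sat []ᵥ []ᵥ = mk⇔ (λ (_ , h) _ → h refl) (λ h → ⊥-elim (h refl))
  pdiffer-sat (x ∷ᵥ xs) (y ∷ᵥ ys) {η = η} = (⇔-refl ⊎-⇔ pdiffer-sat xs ys) ⟫
    mk⇔ (λ { (inj₁ h) e → h (proj₁ (∷-injective e)) ; (inj₂ h) e → h (proj₂ (∷-injective e)) }) back
    where
    back : ev η (x ∷ᵥ xs) ≢ ev η (y ∷ᵥ ys) → lookup η x ≢ lookup η y ⊎ ev η xs ≢ ev η ys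
    back h with lookup η x ≟ᶠ lookup η y
    ... | yes p = inj₂ (λ q → h (cong₂ _∷ᵥ_ p q))
    ... | no ¬p = inj₁ ¬p

  ruleSat : ∀ {Δ} → RelEnv A Δ → Rule {σ} Δ → Set
  ruleSat ρ (derive i φ) = ∀ us → pSat ρ us φ → T (All.lookup ρ i us)
  ruleSat ρ (refute φ)   = ¬ pSat ρ []ᵥ φ

  literal-sat : ∀ {Δ v} (l : BodyLit σ Δ v) {ρ η} → pSat ρ η (literal l) ⇔ litSat A ρ η l
  literal-sat (ratom i xs) = ⇔-refl
  literal-sat (rall j m i ys) {ρ} {η} = pallⁿ-sat m _ ⟫
    Π-⇔ λ as → ≡⇒⇔ (cong (T ∘ All.lookup ρ i) (ev-++ (as ++ η) _ _ (ev-shift as η ys) (ev-firsts as η)))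
  literal-sat (patom true p ys) = ⇔-refl
  literal-sat (patom false p ys) = ⇔-refl
  literal-sat (eatom true y y') = ⇔-refl
  literal-sat (eatom false y y') = ⇔-refl

  conjunction-sat : ∀ {Δ v} (ls : List (BodyLit σ Δ v)) {ρ η} →
                    pSat ρ η (conjunction ls) ⇔ All (litSat A ρ η) ls
  conjunction-sat [] = mk⇔ (λ _ → []) (λ _ → zero , refl)
  conjunction-sat (l ∷ ls) = (literal-sat l ×-⇔ conjunction-sat ls) ⟫
    mk⇔ (λ (p , q) → p ∷ q) (λ { (p ∷ q) → p , q })

  clauseRule-sat : ∀ {Δ v} (c : Clause σ Δ v) {ρ} →
                   (∀ η → clauseSat A ρ η c) ⇔ ruleSat ρ (clauseRule c)
  clauseRule-sat {v = v} (body ⇒ hrel {k} i us) {ρ} = mk⇔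
    (λ h xs s → let (η , p , q) = to (instances xs) s in subst (T ∘ All.lookup ρ i) q (h η p))
    (λ h η p → h (ev η us) (from (instances _) (η , p , refl)))
    where
    instances : ∀ xs → pSat ρ xs (pexⁿ v
                  (pand (ren id (firsts v k) (conjunction body)) (pequal (extend k us) (shift v (allFin k)))))
                ⇔ Σ _ λ η → All (litSat A ρ η) body × ev η us ≡ xs
    instances xs = pexⁿ-sat v _ ⟫ Σ-⇔ λ η →
      (ren-sat (conjunction body) (λ _ → refl) (ev-firsts η xs) ⟫ conjunction-sat body)
      ×-⇔ (pequal-sat (extend k us) (shift v (allFin k))
           ⟫ ≡⇒⇔ (cong₂ _≡_ (ev-extend η xs us) (ev-rests η xs)))
  clauseRule-sat {v = v} (body ⇒ hbot) {ρ} = mk⇔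
    (λ h s → let (η , p) = to instances s in h η p)
    (λ h η p → h (from instances (η , p)))
    where
    instances : pSat ρ []ᵥ (pexⁿ v (ren id (firsts v 0) (conjunction body)))
                ⇔ Σ _ λ η → All (litSat A ρ η) body
    instances = pexⁿ-sat v _ ⟫ Σ-⇔ λ η →
      ren-sat (conjunction body) (λ _ → refl) (ev-firsts η []ᵥ) ⟫ conjunction-sat body

  Π-All-map : ∀ {I X Y : Set} {P : I → X → Set} {Q : Y → Set} (f : X → Y) →
              (∀ x → (∀ i → P i x) ⇔ Q (f x)) → ∀ xs → (∀ i → All (P i) xs) ⇔ All Q (List.map f xs)
  Π-All-map f h [] = mk⇔ (λ _ → []) (λ _ _ → [])
  Π-All-map f h (x ∷ xs) = mk⇔
    (λ p → to (h x) (All.head ∘ p) ∷ to (Π-All-map f h xs) (All.tail ∘ p))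
    (λ { (q ∷ qs) i → from (h x) q i ∷ from (Π-All-map f h xs) qs i })

  module _ {Δ : List ℕ} {k : ℕ} {ρ : RelEnv A Δ} where

    full-sat : ∀ {v} (φ : PF σ (k ∷ Δ) v) {η} →
               pSat ρ η (sub (replace ptrue) φ) ⇔ pSat ((λ _ → true) ∷ ρ) η φ
    full-sat φ = sub-sat φ (replace-interprets (λ _ → mk⇔ (λ _ → tt) (λ _ → zero , refl)))

    ≢? : (us xs : Vec (Univ A) k) → Dec (us ≢ xs)
    ≢? us xs = ¬? (≡-dec _≟ᶠ_ us xs)

    -- By monotonicity R may be taken full, except in the clauses with head R u,
    -- which are violated by some R exactly if they are by the complement of {u}.
    elim∀-sat : ∀ r → (∀ R → ruleSat (R ∷ ρ) r) ⇔ ruleSat ρ (elim∀ {k = k} r)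
    elim∀-sat (derive (here refl) φ) = mk⇔
      (λ h s → let (us , p) = to counterexample s
               in toWitness {a? = ≢? us us} (h (λ xs → isYes (≢? xs us)) us p) refl)
      back
      where
      ψ : PF σ Δ k
      ψ = sub (replace (pdiffer (firsts k k) (shift k (allFin k)))) φ

      counterexample : pSat ρ []ᵥ (pexⁿ k (ren id (firsts k 0) ψ))
                       ⇔ Σ _ λ us → pSat ((λ xs → isYes (≢? xs us)) ∷ ρ) us φ
      counterexample = pexⁿ-sat k _ ⟫ Σ-⇔ λ us → ren-sat ψ (λ _ → refl) (ev-firsts us []ᵥ)
        ⟫ sub-sat φ (replace-interprets λ xs → pdiffer-sat (firsts k k) (shift k (allFin k))
            ⟫ ≡⇒⇔ (cong₂ _≢_ (ev-firsts xs us) (ev-rests xs us))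
            ⟫ mk⇔ (fromWitness {a? = ≢? xs us}) (toWitness {a? = ≢? xs us}))

      back : ruleSat ρ (elim∀ (derive (here refl) φ)) → ∀ R → ruleSat (R ∷ ρ) (derive (here refl) φ)
      back h R us p with T? (R us)
      ... | yes r = r
      ... | no ¬r = ⊥-elim (h (from counterexample (us ,
                      (pSat-mono φ (λ xs r → fromWitness {a? = ≢? xs us} λ { refl → ¬r r }) p))))
    elim∀-sat (derive (there i) φ) = mk⇔ there⇒ there⇐
      where
      there⇒ : (∀ R → ruleSat (R ∷ ρ) (derive (there i) φ)) → ruleSat ρ (elim∀ (derive (there i) φ))
      there⇒ h us p = h (λ _ → true) us (to (full-sat φ) p)
      there⇐ : ruleSat ρ (elim∀ (derive (there i) φ)) → ∀ R → ruleSat (R ∷ ρ) (derive (there i) φ)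
      there⇐ h R us p = h us (from (full-sat φ) (pSat-mono φ (λ _ _ → tt) p))
    elim∀-sat (refute φ) = mk⇔
      (λ h p → h (λ _ → true) (to (full-sat φ) p))
      (λ h R p → h (from (full-sat φ) (pSat-mono φ (λ _ _ → tt) p)))

    least-sat : ∀ φ us → pSat ρ us (least φ) ⇔
      (∀ (S : Vec (Univ A) k → Bool) → (∀ xs → pSat (S ∷ ρ) xs φ → T (S xs)) → T (S us))
    least-sat φ us = Π-⇔ λ S →
      →-cong-⇔ (Π-⇔ λ xs → →-cong-⇔ (ren-sat φ (λ _ → refl) (ev-firsts xs us)) ⇔-refl)
          (≡⇒⇔ (cong (T ∘ S) (ev-allFin us)))

    closed⇒derivation : ∀ rs {R : Vec (Univ A) k → Bool} → All (ruleSat (R ∷ ρ)) rs →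
                        ∀ us → pSat (R ∷ ρ) us (derivation rs) → T (R us)
    closed⇒derivation [] _ us p = ⊥-elim (pfalse-sat {ρ = ρ} {us} p)
    closed⇒derivation (derive (here refl) φ ∷ rs) (h ∷ hs) us (inj₁ p) = h us p
    closed⇒derivation (derive (here refl) φ ∷ rs) (h ∷ hs) us (inj₂ p) = closed⇒derivation rs hs us p
    closed⇒derivation (derive (there i) φ ∷ rs) (h ∷ hs) us p = closed⇒derivation rs hs us p
    closed⇒derivation (refute φ ∷ rs) (h ∷ hs) us p = closed⇒derivation rs hs us p

    module _ (φ : PF σ (k ∷ Δ) k) where

      -- Relation quantifiers range over Boolean relations, so the fixed point must be decided
      -- before it can be a witness for ∃R.
      leastRel : Vec (Univ A) k → Bool
      leastRel us = isYes (pSat? (least φ) ρ us)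

      leastRel-sat : ∀ us → pSat ρ us (least φ) ⇔ T (leastRel us)
      leastRel-sat us = mk⇔ (fromWitness {a? = pSat? (least φ) ρ us}) toWitness

      leastRel-⊆ : ∀ {S} → (∀ xs → pSat (S ∷ ρ) xs φ → T (S xs)) → leastRel ⊆ᵣ S
      leastRel-⊆ {S} pre us p = to (least-sat φ us) (from (leastRel-sat us) p) S pre

      -- Half of the Knaster-Tarski argument: the intersection lies below each prefixed S, so by
      -- monotonicity `φ` at the intersection gives `φ` at S, hence membership in S.
      leastRel-closed : ∀ us → pSat (leastRel ∷ ρ) us φ → T (leastRel us)
      leastRel-closed us p = to (leastRel-sat us) (from (least-sat φ us)
        (λ S pre → pre us (pSat-mono φ (leastRel-⊆ pre) p)))

      sub-least : ∀ {v} (ψ : PF σ (k ∷ Δ) v) {η} →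
        pSat ρ η (sub (replace (ren id (firsts k v) (least φ))) ψ) ⇔ pSat (leastRel ∷ ρ) η ψ
      sub-least ψ {η} = sub-sat ψ (replace-interprets λ us →
        ren-sat (least φ) (λ _ → refl) (ev-firsts us η) ⟫ leastRel-sat us)

      -- Shrinking R to the least relation makes positive bodies harder to satisfy and does not
      -- touch heads other than R.
      elim∃-sound : ∀ {R : Vec (Univ A) k → Bool} r → leastRel ⊆ᵣ R → ruleSat (R ∷ ρ) r → ruleSat ρ (elim∃ (least φ) r)
      elim∃-sound (derive (here refl) ψ) s h = pfalse-sat {ρ = ρ} {[]ᵥ}
      elim∃-sound (derive (there i) ψ) s h us p = h us (pSat-mono ψ s (to (sub-least ψ) p))
      elim∃-sound (refute ψ) s h p = h (pSat-mono ψ s (to (sub-least ψ) p))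

    -- `φ` stays the derivation of the full list while the recursion consumes `rs`; `c` carries
    -- closure under the disjuncts that are still to come.
    elim∃-complete : ∀ φ rs → (∀ us → pSat (leastRel φ ∷ ρ) us (derivation rs) → T (leastRel φ us)) →
      All (ruleSat ρ) (List.map (elim∃ (least φ)) rs) → All (ruleSat (leastRel φ ∷ ρ)) rs
    elim∃-complete φ [] c [] = []
    elim∃-complete φ (derive (here refl) ψ ∷ rs) c (h ∷ hs) =
      (λ us p → c us (inj₁ p)) ∷ elim∃-complete φ rs (λ us p → c us (inj₂ p)) hs
    elim∃-complete φ (derive (there i) ψ ∷ rs) c (h ∷ hs) =
      (λ us p → h us (from (sub-least φ ψ) p)) ∷ elim∃-complete φ rs c hs
    elim∃-complete φ (refute ψ ∷ rs) c (h ∷ hs) =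
      (λ p → h (from (sub-least φ ψ) p)) ∷ elim∃-complete φ rs c hs

    elim∃-sat : ∀ rs → (Σ (Vec (Univ A) k → Bool) λ R → All (ruleSat (R ∷ ρ)) rs) ⇔
                All (ruleSat ρ) (List.map (elim∃ (least (derivation rs))) rs)
    elim∃-sat rs = mk⇔
      (λ (R , h) → map⁺
         (All.map (λ {r} → elim∃-sound φ r (leastRel-⊆ φ (closed⇒derivation rs h))) h))
      (λ h → leastRel φ , elim∃-complete φ rs (leastRel-closed φ) h)
      where
      φ = derivation rs

  rules-sat : ∀ {Δ} (θ : SOHorn σ Δ) {ρ} → soSat A ρ θ ⇔ All (ruleSat ρ) (rules θ)
  rules-sat (matrix v cs) = Π-All-map clauseRule (λ c → clauseRule-sat c) cs
  rules-sat (∀R k θ) = Π-⇔ (λ R → rules-sat θ) ⟫ Π-All-map elim∀ (λ r → elim∀-sat r) (rules θ)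
  rules-sat (∃R k θ) = Σ-⇔ (λ R → rules-sat θ) ⟫ elim∃-sat (rules θ)

  inconsistency-sat : ∀ rs → All (ruleSat []) rs ⇔ (¬ pSat [] []ᵥ (inconsistency rs))
  inconsistency-sat [] = mk⇔ (λ _ → pfalse-sat {ρ = []} {[]ᵥ}) (λ _ → [])
  inconsistency-sat (derive () φ ∷ rs)
  inconsistency-sat (refute φ ∷ rs) = mk⇔
    (λ { (h ∷ hs) → Sum.[ h , to (inconsistency-sat rs) hs ] })
    (λ h → (h ∘ inj₁) ∷ from (inconsistency-sat rs) (h ∘ inj₂))

horn⇒lfp : ∀ {σ} (θ : SOHornSentence σ) → Σ (FOLFPSentence σ) λ ψ →
           (A : Structure σ) → (A ⊨SO θ) ⇔ (A ⊨LFP ψ)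
horn⇒lfp θ = (neg (emb ψ) , emb-WF ψ) , λ A → rules-sat A θ ⟫ inconsistency-sat A (rules θ)
  where ψ = inconsistency (rules θ)

-- Prenexing conjunctions

All-map-⇔ : ∀ {X Y : Set} {P : Y → Set} {Q : X → Set} (f : X → Y) →
            (∀ x → P (f x) ⇔ Q x) → ∀ xs → All P (List.map f xs) ⇔ All Q xs
All-map-⇔ f h [] = mk⇔ (λ _ → []) (λ _ → [])
All-map-⇔ f h (x ∷ xs) = mk⇔ (λ { (p ∷ ps) → to (h x) p ∷ to (All-map-⇔ f h xs) ps })
                              (λ { (q ∷ qs) → from (h x) q ∷ from (All-map-⇔ f h xs) qs })

signed-⇔ : ∀ {X Y : Set} b → X ⇔ Y → signed b X ⇔ signed b Y
signed-⇔ true  f = f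
signed-⇔ false f = ¬-cong-⇔ f

module _ {σ : Sig} where

  renLit : ∀ {Δ Γ v w} → Δ ⊆ₗ Γ → Vec (Fin w) v → BodyLit σ Δ v → BodyLit σ Γ w
  renLit f r (ratom i xs)    = ratom (f i) (ev r xs)
  renLit f r (rall j m i ys) = rall j m (f i) (ev r ys)
  renLit f r (patom b p ys)  = patom b p (ev r ys)
  renLit f r (eatom b y y')  = eatom b (lookup r y) (lookup r y')

  renHead : ∀ {Δ Γ v w} → Δ ⊆ₗ Γ → Vec (Fin w) v → Head Δ v → Head Γ w
  renHead f r (hrel i us) = hrel (f i) (ev r us)
  renHead f r hbot        = hbot

  renClause : ∀ {Δ Γ v w} → Δ ⊆ₗ Γ → Vec (Fin w) v → Clause σ Δ v → Clause σ Γ w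
  renClause f r (body ⇒ h) = List.map (renLit f r) body ⇒ renHead f r h

  renHorn : ∀ {Δ Γ} → Δ ⊆ₗ Γ → SOHorn σ Δ → SOHorn σ Γ
  renHorn f (matrix v cs) = matrix v (List.map (renClause f (allFin v)) cs)
  renHorn f (∀R k θ) = ∀R k (renHorn (under f) θ)
  renHorn f (∃R k θ) = ∃R k (renHorn (under f) θ)

  conjMatrix : ∀ {Δ} v → List (Clause σ Δ v) → SOHorn σ Δ → SOHorn σ Δ
  conjMatrix v cs (matrix w ds) = matrix (v + w)
    (List.map (renClause id (firsts v w)) cs List.++ List.map (renClause id (shift v (allFin w))) ds)
  conjMatrix v cs (∀R k θ) = ∀R k (conjMatrix v (List.map (renClause there (allFin v)) cs) θ)
  conjMatrix v cs (∃R k θ) = ∃R k (conjMatrix v (List.map (renClause there (allFin v)) cs) θ)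

  conj : ∀ {Δ} → SOHorn σ Δ → SOHorn σ Δ → SOHorn σ Δ
  conj (matrix v cs) θ = conjMatrix v cs θ
  conj (∀R k φ) θ = ∀R k (conj φ (renHorn there θ))
  conj (∃R k φ) θ = ∃R k (conj φ (renHorn there θ))

module _ {σ : Sig} (A : Structure σ) where

  renLit-sat : ∀ {Δ Γ v w} (l : BodyLit σ Δ v) {f : Δ ⊆ₗ Γ} {r : Vec (Fin w) v} {ρ ρ' η η'} →
               Preserves f ρ ρ' → ev η' r ≡ η → litSat A ρ' η' (renLit f r l) ⇔ litSat A ρ η l
  renLit-sat (ratom i xs) {r = r} {η' = η'} e refl =
    ≡⇒⇔ (cong₂ (λ R as → T (R as)) (e i) (ev-ev η' r xs))
  renLit-sat (rall j m i ys) {r = r} {η' = η'} e refl =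
    Π-⇔ λ zs → ≡⇒⇔ (cong₂ (λ R as → T (R (as ++ zs))) (e i) (ev-ev η' r ys))
  renLit-sat (patom b p ys) {r = r} {η' = η'} e refl =
    signed-⇔ b (≡⇒⇔ (cong (T ∘ rel A p) (ev-ev η' r ys)))
  renLit-sat (eatom b y y') {r = r} e refl =
    signed-⇔ b (≡⇒⇔ (sym (cong₂ _≡_ (lookup-map y _ r) (lookup-map y' _ r))))

  renHead-sat : ∀ {Δ Γ v w} (h : Head Δ v) {f : Δ ⊆ₗ Γ} {r : Vec (Fin w) v} {ρ : RelEnv A Δ} {ρ' η η'} →
                Preserves f ρ ρ' → ev η' r ≡ η → headSat A ρ' η' (renHead {σ} f r h) ⇔ headSat A ρ η h
  renHead-sat (hrel i us) {r = r} {η' = η'} e refl =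
    ≡⇒⇔ (cong₂ (λ R as → T (R as)) (e i) (ev-ev η' r us))
  renHead-sat hbot e q = ⇔-refl

  renClauses-sat : ∀ {Δ Γ v w} (cs : List (Clause σ Δ v)) {f : Δ ⊆ₗ Γ} {r : Vec (Fin w) v} {ρ ρ' η η'} →
                   Preserves f ρ ρ' → ev η' r ≡ η →
                   All (clauseSat A ρ' η') (List.map (renClause f r) cs) ⇔ All (clauseSat A ρ η) cs
  renClauses-sat cs e q = All-map-⇔ _ (λ (body ⇒ h) →
    →-cong-⇔ (All-map-⇔ _ (λ l → renLit-sat l e q) body) (renHead-sat h e q)) cs

  renHorn-sat : ∀ {Δ Γ} (θ : SOHorn σ Δ) {f : Δ ⊆ₗ Γ} {ρ ρ'} →
                Preserves f ρ ρ' → soSat A ρ' (renHorn f θ) ⇔ soSat A ρ θ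
  renHorn-sat (matrix v cs) e = Π-⇔ λ η → renClauses-sat cs e (ev-allFin η)
  renHorn-sat (∀R k θ) {f} e = Π-⇔ λ R → renHorn-sat θ (under-preserves {f = f} e)
  renHorn-sat (∃R k θ) {f} e = Σ-⇔ λ R → renHorn-sat θ (under-preserves {f = f} e)

  Π-× : ∀ {I : Set} {X Y : I → Set} → (∀ i → X i × Y i) ⇔ ((∀ i → X i) × (∀ i → Y i))
  Π-× = mk⇔ (λ h → (proj₁ ∘ h) , (proj₂ ∘ h)) (λ (f , g) i → f i , g i)

  conjMatrix-sat : ∀ {Δ} v (cs : List (Clause σ Δ v)) θ {ρ} →
    soSat A ρ (conjMatrix v cs θ) ⇔ ((∀ η → All (clauseSat A ρ η) cs) × soSat A ρ θ)
  conjMatrix-sat v cs (matrix w ds) = mk⇔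
    -- The variables of the other matrix are dummies; they are set to `zero`, an element of every
    -- universe.
    (λ h → (λ η → to (renClauses-sat cs (λ _ → refl) (ev-firsts η (replicate w zero)))
                     (proj₁ (++⁻ (List.map _ cs) (h (η ++ replicate w zero)))))
         , (λ η → to (renClauses-sat ds (λ _ → refl) (ev-rests (replicate v zero) η))
                     (proj₂ (++⁻ (List.map _ cs) (h (replicate v zero ++ η))))))
    (λ (f , g) η → ++⁺ (from (renClauses-sat cs (λ _ → refl) refl) (f _))
                       (from (renClauses-sat ds (λ _ → refl) refl) (g _)))
  conjMatrix-sat v cs (∀R k θ) =
    Π-⇔ (λ R → conjMatrix-sat v _ θ ⟫ (Π-⇔ λ η → renClauses-sat cs (λ _ → refl) (ev-allFin η)) ×-⇔ ⇔-refl)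
    -- The left conjunct does not mention R; any relation, here the empty one, removes the vacuous
    -- quantifier.
    ⟫ Π-× ⟫ mk⇔ (λ h → h (λ _ → false)) (λ h _ → h) ×-⇔ ⇔-refl
  conjMatrix-sat v cs (∃R k θ) =
    Σ-⇔ (λ R → conjMatrix-sat v _ θ ⟫ (Π-⇔ λ η → renClauses-sat cs (λ _ → refl) (ev-allFin η)) ×-⇔ ⇔-refl)
    ⟫ mk⇔ (λ (R , p , q) → p , R , q) (λ (p , R , q) → R , p , q)

  conj-sat : ∀ {Δ} (φ θ : SOHorn σ Δ) {ρ} → soSat A ρ (conj φ θ) ⇔ (soSat A ρ φ × soSat A ρ θ)
  conj-sat (matrix v cs) θ = conjMatrix-sat v cs θ
  conj-sat (∀R k φ) θ =
    Π-⇔ (λ R → conj-sat φ _ ⟫ ⇔-refl ×-⇔ renHorn-sat θ (λ _ → refl))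
    ⟫ Π-× ⟫ ⇔-refl ×-⇔ mk⇔ (λ h → h (λ _ → false)) (λ h _ → h)
  conj-sat (∃R k φ) θ =
    Σ-⇔ (λ R → conj-sat φ _ ⟫ ⇔-refl ×-⇔ renHorn-sat θ (λ _ → refl))
    ⟫ mk⇔ (λ (R , p , q) → (R , p) , q) (λ ((R , p) , q) → R , p , q)

-- Horn rules for connectives, quantifiers and fixed points

up : ∀ {Γ : List ℕ} {k m} → k ∈ Γ → k ∈ (m ∷ m ∷ Γ)
up i = there (there i)

-- Of two relation variables bound together, the innermost stands for a formula and the next for its
-- negation.
± : ∀ {Γ : List ℕ} {n} → Bool → n ∈ (n ∷ n ∷ Γ)
± true  = here refl
± false = there (here refl)

-- Not prenex, so that each construct can introduce its own auxiliary relations.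
data Program (σ : Sig) (Γ : List ℕ) : Set where
  rule : ∀ v → List (BodyLit σ Γ v) → Head Γ v → Program σ Γ
  _∧_  : Program σ Γ → Program σ Γ → Program σ Γ
  ∃P   : ∀ k → Program σ (k ∷ Γ) → Program σ Γ

infixr 6 _∧_

module _ {σ : Sig} where

  prenex : ∀ {Γ} → Program σ Γ → SOHorn σ Γ
  prenex (rule v body h) = matrix v ((body ⇒ h) ∷ [])
  prenex (D ∧ E)         = conj (prenex D) (prenex E)
  prenex (∃P k D)        = ∃R k (prenex D)

  ∃± : ∀ {Γ} n → Program σ (n ∷ n ∷ Γ) → Program σ Γ
  ∃± n θ = ∃P n (∃P n θ)

  both : ∀ {Γ} → (Bool → Program σ Γ) → Program σ Γ
  both f = f true ∧ f false

  -- `rall` quantifies trailing arguments, whereas newly bound variables come first. The auxiliary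
  -- relation is a copy of `Q` with the two blocks exchanged.
  forallRule : ∀ {Γ} m n → (m + n) ∈ Γ → n ∈ Γ → Program σ Γ
  forallRule m n Q P = ∃P (n + m)
    ( rule (m + n) (ratom (there Q) (firsts m n ++ shift m (allFin n)) ∷ [])
           (hrel (here refl) (shift m (allFin n) ++ firsts m n))
    ∧ rule n (rall n m (here refl) (allFin n) ∷ []) (hrel (there P) (allFin n)))

  -- By De Morgan, conjunction and disjunction differ only in the sign `b` that requires both parts:
  -- true for `and`, false for `or`. Either part alone gives the opposite sign.
  junction : ∀ {Γ n} → Bool → (Bool → n ∈ Γ) → Program σ (n ∷ n ∷ n ∷ n ∷ Γ) →
             Program σ (n ∷ n ∷ n ∷ n ∷ Γ) → Program σ Γ
  junction {n = n} b P D E = ∃± n (∃± n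
    ( rule n (ratom (up (± b)) (allFin n) ∷ ratom (± b) (allFin n) ∷ []) (hrel (up (up (P b))) (allFin n))
    ∧ rule n (ratom (up (± (not b))) (allFin n) ∷ []) (hrel (up (up (P (not b)))) (allFin n))
    ∧ rule n (ratom (± (not b)) (allFin n) ∷ []) (hrel (up (up (P (not b)))) (allFin n))
    ∧ D ∧ E))

  quantifier : ∀ {Γ n} → Bool → (Bool → n ∈ Γ) → Program σ (suc n ∷ suc n ∷ Γ) → Program σ Γ
  quantifier {n = n} b P D = ∃± (suc n)
    ( forallRule 1 n (± b) (up (P b))
    ∧ rule (1 + n) (ratom (± (not b)) (firsts 1 n ++ shift 1 (allFin n)) ∷ []) (hrel (up (P (not b))) (shift 1 (allFin n)))
    ∧ D)

  -- F adds nothing to the stage of y if each x is outside its image (`W⁻`) or already in the stage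
  -- (`L⁺`). A universal prefix applies to a single relation only, so the disjunction is first
  -- collected in one auxiliary relation, and a second one records the y for which it is total.
  finalStage : ∀ {Γ} k n → Vec (Fin n) k → (W⁻ L⁺ L⁻ : (k + (k + n)) ∈ Γ) → n ∈ Γ → Program σ Γ
  finalStage k n ts W⁻ L⁺ L⁻ P⁻ = ∃P (k + (k + n))
    ( rule (k + (k + n)) (ratom (there W⁻) (x ++ (y ++ c)) ∷ []) (hrel (here refl) (x ++ (y ++ c)))
    ∧ rule (k + (k + n)) (ratom (there L⁺) (x ++ (y ++ c)) ∷ []) (hrel (here refl) (x ++ (y ++ c)))
    ∧ ∃P (k + n)
      ( forallRule k (k + n) (there (here refl)) (here refl)
      ∧ rule (k + n) (ratom (here refl) (firsts k n ++ shift k (allFin n))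
                     ∷ ratom (there (there L⁻)) (shift k ts ++ (firsts k n ++ shift k (allFin n))) ∷ [])
             (hrel (there (there P⁻)) (shift k (allFin n)))))
    where
    x y : Vec (Fin (k + (k + n))) k
    x = firsts k (k + n)
    y = shift k (firsts k n)
    c : Vec (Fin (k + (k + n))) n
    c = shift k (shift k (allFin n))

  initialRule : ∀ {Γ} k n → (Bool → (k + n) ∈ Γ) → (Bool → (k + (k + n)) ∈ Γ) → Bool → Program σ Γ
  initialRule k n I L b = rule (k + (k + n))
    (ratom (I true) (z ++ c) ∷ ratom (I b) (x ++ c) ∷ []) (hrel (L b) (x ++ (z ++ c)))
    where
    x z : Vec (Fin (k + (k + n))) k
    x = firsts k (k + n)
    z = shift k (firsts k n)
    c : Vec (Fin (k + (k + n))) n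
    c = shift k (shift k (allFin n))

  successorRule : ∀ {Γ} k n → (L W : Bool → (k + (k + n)) ∈ Γ) → Bool → Program σ Γ
  successorRule k n L W b = rule (k + (k + (k + n)))
    (ratom (L false) (z ++ (y ++ c)) ∷ ratom (W true) (z ++ (y ++ c)) ∷ ratom (W b) (x ++ (y ++ c)) ∷ [])
    (hrel (L b) (x ++ (z ++ c)))
    where
    x z y : Vec (Fin (k + (k + (k + n)))) k
    x = firsts k (k + (k + n))
    z = shift k (firsts k (k + n))
    y = shift k (shift k (firsts k n))
    c : Vec (Fin (k + (k + (k + n)))) n
    c = shift k (shift k (shift k (allFin n)))

  -- Intended reading, for the fixed point of an operator F depending on c: Z is empty,
  -- I(x,c) is x ∈ F(∅), L(x,y,c) says that x belongs to the first stage containing y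
  -- (to the fixed point if no stage does), and W(x,y,c) that F sends that stage to a
  -- set containing x. If z is new in F(∅), or in the image of the stage of y, then that
  -- image is the stage of z. Each of D and E defines one application of F, to Z and to L.
  fixpoint : ∀ {Γ} k {n} → Vec (Fin n) k → (Bool → n ∈ Γ) →
             let Γ' = (k + (k + n)) ∷ (k + (k + n)) ∷ (k + n) ∷ (k + n) ∷
                      (k + (k + n)) ∷ (k + (k + n)) ∷ (k + 0) ∷ (k + 0) ∷ Γ
             in Program σ Γ' → Program σ Γ' → Program σ Γ
  fixpoint {Γ} k {n} ts P D E = ∃± (k + 0) (∃± (k + (k + n)) (∃± (k + n) (∃± (k + (k + n))
    ( rule (k + 0) [] (hrel (Z false) (firsts k 0 ++ []ᵥ))
    ∧ D ∧ E
    ∧ both (initialRule k n I L)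
    ∧ both (successorRule k n L W)
    -- Whatever stage y names, it lies inside the fixed point, so y is not tested.
    ∧ rule (k + n) (ratom (L true) (shift k ts ++ (firsts k n ++ shift k (allFin n))) ∷ [])
           (hrel (up (up (up (up (P true))))) (shift k (allFin n)))
    -- If F(∅) is empty, there is no new element to name a stage; an empty fixed point is therefore
    -- recognized directly.
    ∧ forallRule k n (I false) (up (up (up (up (P false)))))
    ∧ finalStage k n ts (W false) (L true) (L false) (up (up (up (up (P false)))))))))
    where
    Γ' : List ℕ
    Γ' = (k + (k + n)) ∷ (k + (k + n)) ∷ (k + n) ∷ (k + n) ∷
         (k + (k + n)) ∷ (k + (k + n)) ∷ (k + 0) ∷ (k + 0) ∷ Γ
    W L : Bool → (k + (k + n)) ∈ Γ'
    W b = ± b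
    L b = up (up (± b))
    I : Bool → (k + n) ∈ Γ'
    I b = up (± b)
    Z : Bool → (k + 0) ∈ Γ'
    Z b = up (up (up (± b)))

-- Semantic reading of the Horn rules

premise : ∀ {X : Set} {P : X → Set} {l ls} {H Y Z : Set} →
          P l ⇔ Y → (All P ls → H) ⇔ Z → (All P (l ∷ ls) → H) ⇔ (Y → Z)
premise f g = mk⇔ (λ h y → to g (λ ps → h (from f y ∷ ps))) (λ { h (p ∷ ps) → from g (h (to f p)) ps })

conclusion : ∀ {X : Set} {P : X → Set} {H Y : Set} → H ⇔ Y → (All P [] → H) ⇔ Y
conclusion f = mk⇔ (λ h → to f (h [])) (λ h _ → from f h)

module _ {U : Set} where

  -- Stating the blocks by equations lets one `f` serve both directions: for a concatenation they
  -- are proved, for an arbitrary assignment they are `refl`.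
  blocks₂ : ∀ {a b} {P : Vec U (a + b) → Set} {Q : Vec U a → Vec U b → Set} →
    (∀ {η x y} → ev η (firsts a b) ≡ x → ev η (shift a (allFin b)) ≡ y → P η ⇔ Q x y) →
    (∀ η → P η) ⇔ (∀ x y → Q x y)
  blocks₂ f = mk⇔ (λ h x y → to (f (ev-firsts x y) (ev-rests x y)) (h (x ++ y)))
                  (λ h η → from (f refl refl) (h _ _))

  blocks₃ : ∀ {a b c} {P : Vec U (a + (b + c)) → Set} {Q : Vec U a → Vec U b → Vec U c → Set} →
    (∀ {η x y z} → ev η (firsts a (b + c)) ≡ x → ev η (shift a (firsts b c)) ≡ y →
       ev η (shift a (shift b (allFin c))) ≡ z → P η ⇔ Q x y z) →
    (∀ η → P η) ⇔ (∀ x y z → Q x y z)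
  blocks₃ f = mk⇔
    (λ h x y z → to (f (ev-firsts x (y ++ z))
                       (trans (ev-shift x (y ++ z) _) (ev-firsts y z))
                       (trans (ev-shift x (y ++ z) _) (ev-rests y z))) (h (x ++ (y ++ z))))
    (λ h η → from (f refl refl refl) (h _ _ _))

  blocks₄ : ∀ {a b c d} {P : Vec U (a + (b + (c + d))) → Set}
              {Q : Vec U a → Vec U b → Vec U c → Vec U d → Set} →
    (∀ {η x y z w} → ev η (firsts a (b + (c + d))) ≡ x → ev η (shift a (firsts b (c + d))) ≡ y →
       ev η (shift a (shift b (firsts c d))) ≡ z → ev η (shift a (shift b (shift c (allFin d)))) ≡ w →
       P η ⇔ Q x y z w) →
    (∀ η → P η) ⇔ (∀ x y z w → Q x y z w)
  blocks₄ f = mk⇔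
    (λ h x y z w → to (f (ev-firsts x (y ++ (z ++ w)))
                         (trans (ev-shift x (y ++ (z ++ w)) _) (ev-firsts y (z ++ w)))
                         (trans (ev-shift x (y ++ (z ++ w)) _)
                           (trans (ev-shift y (z ++ w) _) (ev-firsts z w)))
                         (trans (ev-shift x (y ++ (z ++ w)) _)
                           (trans (ev-shift y (z ++ w) _) (ev-rests z w))))
                      (h (x ++ (y ++ (z ++ w)))))
    (λ h η → from (f refl refl refl refl) (h _ _ _ _))

Bool-⇔ : ∀ {X Y : Bool → Set} → (∀ b → X b ⇔ Y b) → (X true × X false) ⇔ (∀ b → Y b)
Bool-⇔ h = mk⇔ (λ { (p , q) true → to (h true) p ; (p , q) false → to (h false) q })
               (λ p → from (h true) (p true) , from (h false) (p false))

module _ {σ : Sig} (A : Structure σ) where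

  Rel : ℕ → Set
  Rel n = Vec (Univ A) n → Bool

  progSat : ∀ {Γ} → RelEnv A Γ → Program σ Γ → Set
  progSat M (rule v body h) = ∀ η → clauseSat A M η (body ⇒ h)
  progSat M (D ∧ E) = progSat M D × progSat M E
  progSat M (∃P k D) = Σ (Rel k) λ R → progSat (R ∷ M) D

  prenex-sat : ∀ {Γ} (D : Program σ Γ) {M} → soSat A M (prenex D) ⇔ progSat M D
  prenex-sat (rule v body h) = Π-⇔ λ η → mk⇔ All.head (λ p → p ∷ [])
  prenex-sat (D ∧ E) = conj-sat A (prenex D) (prenex E) ⟫ prenex-sat D ×-⇔ prenex-sat E
  prenex-sat (∃P k D) = Σ-⇔ λ R → prenex-sat D

  pair-Σ : ∀ {n} {Y : Rel n → Rel n → Set} {X : (Bool → Rel n) → Set} →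
           (∀ R → Y (R true) (R false) ⇔ X R) →
           (Σ (Rel n) λ R⁻ → Σ (Rel n) λ R⁺ → Y R⁺ R⁻) ⇔ Σ (Bool → Rel n) X
  pair-Σ {n} {Y} {X} h = mk⇔ pair (λ (R , x) → R false , R true , from (h R) x)
    where
    pair : (Σ (Rel n) λ R⁻ → Σ (Rel n) λ R⁺ → Y R⁺ R⁻) → Σ (Bool → Rel n) X
    pair (R⁻ , R⁺ , p) = R , to (h R) p
      where
      R : Bool → Rel n
      R true  = R⁺
      R false = R⁻

  lookup-± : ∀ {Γ n} (R : Bool → Rel n) {M : RelEnv A Γ} b →
             All.lookup (R true ∷ R false ∷ M) (± b) ≡ R b
  lookup-± R true  = refl
  lookup-± R false = refl

  atom : ∀ {Γ n k} (M : RelEnv A Γ) (i : k ∈ Γ) {S : Rel k} (η : Vec (Univ A) n) X {xs} →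
         All.lookup M i ≡ S → ev η X ≡ xs → T (All.lookup M i (ev η X)) ⇔ T (S xs)
  atom M i η X refl refl = ⇔-refl

  forallRule-sat : ∀ {Γ} m n (Q : (m + n) ∈ Γ) (P : n ∈ Γ) {M} →
    progSat M (forallRule m n Q P) ⇔
      (∀ c → (∀ x → T (All.lookup M Q (x ++ c))) → T (All.lookup M P c))
  forallRule-sat m n Q P {M} = expand ⟫ mk⇔
    (λ (R , copy , use) c h → use c (λ x → copy x c (h x)))
    (λ h → (λ v → All.lookup M Q (ev v (shift n (allFin m)) ++ ev v (firsts n m)))
         , (λ x c → subst (T ∘ All.lookup M Q) (sym (cong₂ _++_ (ev-rests c x) (ev-firsts c x))))
         , (λ c f → h c λ x → subst (T ∘ All.lookup M Q) (cong₂ _++_ (ev-rests c x) (ev-firsts c x)) (f x)))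
    where
    expand : progSat M (forallRule m n Q P) ⇔ Σ (Rel (n + m)) λ R →
      (∀ (x : Vec _ m) (c : Vec _ n) → T (All.lookup M Q (x ++ c)) → T (R (c ++ x)))
      × (∀ c → (∀ x → T (R (c ++ x))) → T (All.lookup M P c))
    expand = Σ-⇔ λ R →
      blocks₂ (λ { {η} refl refl →
        premise (atom (R ∷ M) (there Q) η _ refl (ev-++ η (firsts m n) _ refl refl))
                (conclusion (atom (R ∷ M) (here refl) η _ refl (ev-++ η (shift m (allFin n)) _ refl refl))) })
      ×-⇔ Π-⇔ λ η → premise (Π-⇔ λ zs → ≡⇒⇔ (cong (λ c → T (R (c ++ zs))) (ev-allFin η)))
                            (conclusion (atom (R ∷ M) (there P) η (allFin n) refl (ev-allFin η)))

  JunctionSat : ∀ {Γ n} → Bool → (Bool → n ∈ Γ) → RelEnv A Γ → (Q R : Bool → Rel n) → Set → Set → Set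
  JunctionSat b P M Q R D E =
    (∀ c → T (Q b c) → T (R b c) → T (All.lookup M (P b) c))
    × (∀ c → T (Q (not b) c) → T (All.lookup M (P (not b)) c))
    × (∀ c → T (R (not b) c) → T (All.lookup M (P (not b)) c))
    × D × E

  junction-sat : ∀ {Γ n} b (P : Bool → n ∈ Γ) D E {M} →
    progSat M (junction b P D E) ⇔ Σ (Bool → Rel n) λ Q → Σ (Bool → Rel n) λ R →
      let M' = R true ∷ R false ∷ Q true ∷ Q false ∷ M
      in JunctionSat b P M Q R (progSat M' D) (progSat M' E)
  junction-sat {n = n} b P D E {M} = pair-Σ λ Q → pair-Σ λ R →
    let M' = R true ∷ R false ∷ Q true ∷ Q false ∷ M
        at : ∀ {S} (i : n ∈ _) η → All.lookup M' i ≡ S → T (All.lookup M' i (ev η (allFin n))) ⇔ T (S η)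
        at i η e = atom M' i η (allFin n) e (ev-allFin η)
    in (Π-⇔ λ η → premise (at (up (± b)) η (lookup-± Q b)) (premise (at (± b) η (lookup-± R b))
                    (conclusion (at (up (up (P b))) η refl))))
       ×-⇔ (Π-⇔ λ η → premise (at (up (± (not b))) η (lookup-± Q (not b)))
                        (conclusion (at (up (up (P (not b)))) η refl)))
       ×-⇔ (Π-⇔ λ η → premise (at (± (not b)) η (lookup-± R (not b)))
                        (conclusion (at (up (up (P (not b)))) η refl)))
       ×-⇔ ⇔-refl

  quantifier-sat : ∀ {Γ n} b (P : Bool → n ∈ Γ) D {M} →
    progSat M (quantifier b P D) ⇔ Σ (Bool → Rel (suc n)) λ Q →
      (∀ c → (∀ x → T (Q b (x ++ c))) → T (All.lookup M (P b) c))
      × (∀ x c → T (Q (not b) (x ++ c)) → T (All.lookup M (P (not b)) c))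
      × progSat (Q true ∷ Q false ∷ M) D
  quantifier-sat {n = n} b P D {M} = pair-Σ λ Q →
    let M' = Q true ∷ Q false ∷ M in
    (forallRule-sat 1 n (± b) (up (P b)) {M'} ⟫ Π-⇔ λ c →
       →-cong-⇔ (Π-⇔ λ x → ≡⇒⇔ (cong (λ R → T (R (x ++ c))) (lookup-± Q b))) ⇔-refl)
    ×-⇔ blocks₂ {a = 1} (λ { {η} refl refl →
          premise (atom M' (± (not b)) η _ (lookup-± Q (not b)) (ev-++ η (firsts 1 n) _ refl refl))
                  (conclusion (atom M' (up (P (not b))) η _ refl refl)) })
    ×-⇔ ⇔-refl

  finalStage-sat : ∀ {Γ} k n ts (W⁻ L⁺ L⁻ : (k + (k + n)) ∈ Γ) (P⁻ : n ∈ Γ) {M} →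
    progSat M (finalStage {σ} k n ts W⁻ L⁺ L⁻ P⁻) ⇔ (∀ y c →
      (∀ x → T (All.lookup M W⁻ (x ++ (y ++ c))) ⊎ T (All.lookup M L⁺ (x ++ (y ++ c)))) →
      T (All.lookup M L⁻ (ev c ts ++ (y ++ c))) → T (All.lookup M P⁻ c))
  finalStage-sat k n ts W⁻ L⁺ L⁻ P⁻ {M} = expand ⟫ mk⇔
    (λ (S , w , l , F , f , p) y c h → p y c (f (y ++ c) λ x → Sum.[ w x y c , l x y c ] (h x)))
    -- The auxiliary relations take their least values: the union itself, and the set of tuples for
    -- which it is total.
    (λ h → (λ v → All.lookup M W⁻ v ∨ All.lookup M L⁺ v)
         , (λ x y c t → from T-∨ (inj₁ t))
         , (λ x y c t → from T-∨ (inj₂ t))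
         , (λ v → isYes (F? v))
         , (λ v t → fromWitness {a? = F? v} t)
         , (λ y c t → h y c (λ x → to T-∨ (toWitness {a? = F? (y ++ c)} t x))))
    where
    F? : ∀ v → Dec (∀ x → T (All.lookup M W⁻ (x ++ v) ∨ All.lookup M L⁺ (x ++ v)))
    F? v = all-vec? (λ x → T? _)

    expand : progSat M (finalStage {σ} k n ts W⁻ L⁺ L⁻ P⁻) ⇔ Σ (Rel (k + (k + n))) λ S →
      (∀ x y c → T (All.lookup M W⁻ (x ++ (y ++ c))) → T (S (x ++ (y ++ c))))
      × (∀ x y c → T (All.lookup M L⁺ (x ++ (y ++ c))) → T (S (x ++ (y ++ c))))
      × Σ (Rel (k + n)) λ F →
        (∀ v → (∀ x → T (S (x ++ v))) → T (F v))
        × (∀ y c → T (F (y ++ c)) → T (All.lookup M L⁻ (ev c ts ++ (y ++ c))) → T (All.lookup M P⁻ c))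
    expand = Σ-⇔ λ S →
      blocks₃ (λ { {η} refl refl refl →
        let e = ev-++₃ η (firsts k (k + n)) (shift k (firsts k n)) _ refl refl refl in
        premise (atom (S ∷ M) (there W⁻) η _ refl e) (conclusion (atom (S ∷ M) (here refl) η _ refl e)) })
      ×-⇔ blocks₃ (λ { {η} refl refl refl →
        let e = ev-++₃ η (firsts k (k + n)) (shift k (firsts k n)) _ refl refl refl in
        premise (atom (S ∷ M) (there L⁺) η _ refl e) (conclusion (atom (S ∷ M) (here refl) η _ refl e)) })
      ×-⇔ Σ-⇔ λ F →
        forallRule-sat k (k + n) (there (here refl)) (here refl) {F ∷ S ∷ M}
        ×-⇔ blocks₂ (λ { {η} refl refl →
          premise (atom (F ∷ S ∷ M) (here refl) η _ refl (ev-++ η (firsts k n) _ refl refl))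
          (premise (atom (F ∷ S ∷ M) (there (there L⁻)) η _ refl
                     (ev-++₃ η (shift k ts) (firsts k n) _ (ev-tail η ts) refl refl))
          (conclusion (atom (F ∷ S ∷ M) (there (there P⁻)) η _ refl refl))) })

  initialRule-sat : ∀ {Γ} k n (I : Bool → (k + n) ∈ Γ) L b {M} {I' : Bool → Rel (k + n)}
    {L' : Bool → Rel (k + (k + n))} →
    (∀ b → All.lookup M (I b) ≡ I' b) → (∀ b → All.lookup M (L b) ≡ L' b) →
    progSat M (initialRule {σ} k n I L b) ⇔ (∀ (x z : Vec _ k) (c : Vec _ n) →
      T (I' true (z ++ c)) → T (I' b (x ++ c)) → T (L' b (x ++ (z ++ c))))
  initialRule-sat k n I L b {M} eI eL = blocks₃ λ { {η} refl refl refl →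
    let x = firsts k (k + n) ; z = shift k (firsts k n) in
    premise (atom M (I true) η _ (eI true) (ev-++ η z _ refl refl))
    (premise (atom M (I b) η _ (eI b) (ev-++ η x _ refl refl))
    (conclusion (atom M (L b) η _ (eL b) (ev-++₃ η x z _ refl refl refl)))) }

  successorRule-sat : ∀ {Γ} k n (L W : Bool → (k + (k + n)) ∈ Γ) b {M}
    {L' W' : Bool → Rel (k + (k + n))} →
    (∀ b → All.lookup M (L b) ≡ L' b) → (∀ b → All.lookup M (W b) ≡ W' b) →
    progSat M (successorRule {σ} k n L W b) ⇔ (∀ (x z y : Vec _ k) (c : Vec _ n) →
      T (L' false (z ++ (y ++ c))) → T (W' true (z ++ (y ++ c))) → T (W' b (x ++ (y ++ c))) →
      T (L' b (x ++ (z ++ c))))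
  successorRule-sat k n L W b {M} eL eW = blocks₄ λ { {η} refl refl refl refl →
    let x = firsts k (k + (k + n)) ; z = shift k (firsts k (k + n)) ; y = shift k (shift k (firsts k n)) in
    premise (atom M (L false) η _ (eL false) (ev-++₃ η z y _ refl refl refl))
    (premise (atom M (W true) η _ (eW true) (ev-++₃ η z y _ refl refl refl))
    (premise (atom M (W b) η _ (eW b) (ev-++₃ η x y _ refl refl refl))
    (conclusion (atom M (L b) η _ (eL b) (ev-++₃ η x z _ refl refl refl))))) }

  FixpointSat : ∀ {Γ} k {n} → Vec (Fin n) k → (Bool → n ∈ Γ) → RelEnv A Γ →
                (Z : Bool → Rel (k + 0)) (L : Bool → Rel (k + (k + n)))
                (I : Bool → Rel (k + n)) (W : Bool → Rel (k + (k + n))) → Set → Set → Set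
  FixpointSat k {n} ts P M Z L I W D E =
    (∀ (x : Vec _ k) → T (Z false (x ++ []ᵥ)))
    × D × E
    × (∀ b (x z : Vec _ k) (c : Vec _ n) → T (I true (z ++ c)) → T (I b (x ++ c)) → T (L b (x ++ (z ++ c))))
    × (∀ b (x z y : Vec _ k) (c : Vec _ n) → T (L false (z ++ (y ++ c))) → T (W true (z ++ (y ++ c))) →
         T (W b (x ++ (y ++ c))) → T (L b (x ++ (z ++ c))))
    × (∀ (y : Vec _ k) (c : Vec _ n) → T (L true (ev c ts ++ (y ++ c))) → T (All.lookup M (P true) c))
    × (∀ c → (∀ (x : Vec _ k) → T (I false (x ++ c))) → T (All.lookup M (P false) c))
    × (∀ (y : Vec _ k) (c : Vec _ n) → (∀ (x : Vec _ k) → T (W false (x ++ (y ++ c))) ⊎ T (L true (x ++ (y ++ c)))) →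
         T (L false (ev c ts ++ (y ++ c))) → T (All.lookup M (P false) c))

  fixpoint-sat : ∀ {Γ} k {n} (ts : Vec (Fin n) k) (P : Bool → n ∈ Γ) D E {M} →
    progSat M (fixpoint {σ} k ts P D E) ⇔
      Σ (Bool → Rel (k + 0)) λ Z → Σ (Bool → Rel (k + (k + n))) λ L →
      Σ (Bool → Rel (k + n)) λ I → Σ (Bool → Rel (k + (k + n))) λ W →
      let M' = W true ∷ W false ∷ I true ∷ I false ∷ L true ∷ L false ∷ Z true ∷ Z false ∷ M
      in FixpointSat k ts P M Z L I W (progSat M' D) (progSat M' E)
  fixpoint-sat {Γ} k {n} ts P D E {M} = pair-Σ λ Z → pair-Σ λ L → pair-Σ λ I → pair-Σ λ W →
    let ML = Z true ∷ Z false ∷ M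
        MI = L true ∷ L false ∷ ML
        MW = I true ∷ I false ∷ MI
        M' = W true ∷ W false ∷ MW
        w : Bool → (k + (k + n)) ∈ _
        w b = ± b
        l : Bool → (k + (k + n)) ∈ _
        l b = up (up (± b))
        i : Bool → (k + n) ∈ _
        i b = up (± b)
        z : (k + 0) ∈ _
        z = up (up (up (± false)))
        p : Bool → n ∈ _
        p b = up (up (up (up (P b))))
    in
    (Π-⇔ (λ η → conclusion (atom M' z η (firsts k 0 ++ []ᵥ) (lookup-± Z {M} false) (ev-++ η (firsts k 0) []ᵥ refl refl)))
      ⟫ mk⇔ (λ h x → subst (λ y → T (Z false (y ++ []ᵥ))) (ev-firsts x []ᵥ) (h (x ++ []ᵥ))) (λ h η → h _))
    ×-⇔ ⇔-refl
    ×-⇔ ⇔-refl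
    ×-⇔ Bool-⇔ {X = λ b → progSat M' (initialRule k n i l b)}
          (λ b → initialRule-sat k n i l b (lookup-± I {MI}) (lookup-± L {ML}))
    ×-⇔ Bool-⇔ {X = λ b → progSat M' (successorRule k n l w b)}
          (λ b → successorRule-sat k n l w b (lookup-± L {ML}) (lookup-± W {MW}))
    ×-⇔ blocks₂ {a = k} {n} (λ { {η} refl refl →
          premise (atom M' (l true) η _ (lookup-± L {ML} true)
                    (ev-++₃ η (shift k ts) (firsts k n) _ (ev-tail η ts) refl refl))
          (conclusion (atom M' (p true) η _ refl refl)) })
    ×-⇔ (forallRule-sat k n (i false) (p false) {M'} ⟫ Π-⇔ λ c →
          →-cong-⇔ (Π-⇔ λ x → ≡⇒⇔ (cong (λ R → T (R (x ++ c))) (lookup-± I {MI} false))) ⇔-refl)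
    ×-⇔ finalStage-sat k n ts (w false) (l true) (l false) (p false) {M'}

-- From fixed points to Horn sentences

-- A relation variable of the fixed-point logic is represented by a pair of Horn
-- relation variables, for it and for its complement, applied to further arguments.
record Entry (Γ : List ℕ) (n k : ℕ) : Set where
  constructor entry
  field
    {extra} : ℕ
    symbol  : Bool → (k + extra) ∈ Γ
    args    : Vec (Fin n) extra

open Entry

Env : List ℕ → List ℕ → ℕ → Set
Env Δ Γ n = ∀ {k} → k ∈ Δ → Entry Γ n k

raise : ∀ {Δ Γ Γ' n} → Γ ⊆ₗ Γ' → Env Δ Γ n → Env Δ Γ' n
raise f e i = entry (f ∘ e i .symbol) (e i .args)

reindex : ∀ {Δ Γ n n'} → Vec (Fin n') n → Env Δ Γ n → Env Δ Γ n'
reindex r e i = entry (e i .symbol) (ev r (e i .args))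

_▸_ : ∀ {Δ Γ n k} → Entry Γ n k → Env Δ Γ n → Env (k ∷ Δ) Γ n
(x ▸ e) (here refl) = x
(x ▸ e) (there i)   = e i

up² : ∀ {Γ : List ℕ} {k m m'} → k ∈ Γ → k ∈ (m ∷ m ∷ m' ∷ m' ∷ Γ)
up² i = up (up i)

up⁴ : ∀ {Γ : List ℕ} {k a b c d} → k ∈ Γ → k ∈ (a ∷ a ∷ b ∷ b ∷ c ∷ c ∷ d ∷ d ∷ Γ)
up⁴ i = up² (up² i)

module _ {σ : Sig} where

  atomic : ∀ {Γ n} → (Bool → BodyLit σ Γ n) → (Bool → n ∈ Γ) → Program σ Γ
  atomic {n = n} l P = both λ b → rule n (l b ∷ []) (hrel (P b) (allFin n))

  -- r gives the variables of φ among the n variables of the Horn program; P true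
  -- and P false are relations for φ and its negation, as functions of the latter.
  compile : ∀ {Δ Γ v n} → FLFP σ Δ v → Vec (Fin n) v → Env Δ Γ n → (Bool → n ∈ Γ) → Program σ Γ
  compile (ratm p ts) r e P = atomic (λ b → patom b p (ev r ts)) P
  compile (eq s t) r e P = atomic (λ b → eatom b (lookup r s) (lookup r t)) P
  compile (rvar i ts) r e P = atomic (λ b → ratom (e i .symbol b) (ev r ts ++ e i .args)) P
  compile (neg φ) r e P = compile φ r e (P ∘ not)
  compile (and φ ψ) r e P = junction true P
    (compile φ r (raise up² e) (up ∘ ±)) (compile ψ r (raise up² e) ±)
  compile (or φ ψ) r e P = junction false P
    (compile φ r (raise up² e) (up ∘ ±)) (compile ψ r (raise up² e) ±)
  compile {n = n} (all φ) r e P =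
    quantifier true P (compile φ (lift 1 r) (raise up (reindex (shift 1 (allFin n)) e)) ±)
  compile {n = n} (ex φ) r e P =
    quantifier false P (compile φ (lift 1 r) (raise up (reindex (shift 1 (allFin n)) e)) ±)
  compile {n = n} (lfp k φ ts) r e P = fixpoint k (ev r ts) P
    (compile φ (lift k r)
      (entry (up ∘ up² ∘ ±) []ᵥ ▸ raise up⁴ (reindex (shift k (allFin n)) e)) (up ∘ ±))
    (compile φ (firsts k (k + n) ++ shift k (shift k r))
      (entry (up² ∘ ±) (shift k (allFin (k + n))) ▸ raise up⁴ (reindex (shift k (shift k (allFin n))) e)) ±)

signed? : ∀ {X : Set} b → Dec X → Dec (signed b X)
signed? true  d = d
signed? false d = ¬? d

signed-neg : ∀ {X : Set} b → signed (not b) X → signed b (¬ X)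
signed-neg true  ¬x = ¬x
signed-neg false x ¬x = ¬x x

module _ {U : Set} {n : ℕ} {X : Vec U n → Set} (X? : ∀ c → Dec (X c)) where

  graph : Bool → Vec U n → Bool
  graph b c = isYes (signed? b (X? c))

  graph-sat : ∀ b c → T (graph b c) ⇔ signed b (X c)
  graph-sat b c = mk⇔ toWitness (fromWitness {a? = signed? b (X? c)})

-- The exact truth values satisfy the compiled program

module _ {σ : Sig} (A : Structure σ) where

  -- Upper bounds, where `EnvComplete` gives lower bounds. A model must be built for all assignments
  -- at once, and the recursion variable denotes different stages at different `c`, so here `ρ`
  -- depends on `c`; for completeness one `c` is considered at a time.
  record EnvSound {Δ Γ n} (M : RelEnv A Γ) (e : Env Δ Γ n) (ρ : Vec (Univ A) n → RelEnv A Δ) : Set where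
    field
      sound-at : ∀ {k} (i : k ∈ Δ) b c ts →
        T (All.lookup M (e i .symbol b) (ts ++ ev c (e i .args))) → signed b (T (All.lookup (ρ c) i ts))

  record EnvComplete {Δ Γ n} (M : RelEnv A Γ) (e : Env Δ Γ n) (c : Vec (Univ A) n) (ρ : RelEnv A Δ) : Set where
    field
      complete-at : ∀ {k} (i : k ∈ Δ) b ts →
        signed b (T (All.lookup ρ i ts)) → T (All.lookup M (e i .symbol b) (ts ++ ev c (e i .args)))

  open EnvSound
  open EnvComplete

  raise-sound : ∀ {Δ Γ Γ' n} (f : Γ ⊆ₗ Γ') {M M'} {e : Env Δ Γ n} {ρ} →
    Preserves f M M' → EnvSound M e ρ → EnvSound M' (raise f e) ρ
  raise-sound f {e = e} pr h .sound-at i b c ts t =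
    h .sound-at i b c ts (subst (λ R → T (R (ts ++ ev c (e i .args)))) (pr (e i .symbol b)) t)

  raise-complete : ∀ {Δ Γ Γ' n} (f : Γ ⊆ₗ Γ') {M M'} {e : Env Δ Γ n} {ρ c} →
    Preserves f M M' → EnvComplete M e c ρ → EnvComplete M' (raise f e) c ρ
  raise-complete f {e = e} {c = c} pr h .complete-at i b ts s =
    subst (λ R → T (R (ts ++ ev c (e i .args)))) (sym (pr (e i .symbol b))) (h .complete-at i b ts s)

  reindex-sound : ∀ {Δ Γ n n'} {M : RelEnv A Γ} {e : Env Δ Γ n} {ρ} (r : Vec (Fin n') n) →
    EnvSound M e ρ → EnvSound M (reindex r e) (λ v → ρ (ev v r))
  reindex-sound {M = M} {e} r h .sound-at i b v ts t = h .sound-at i b (ev v r) ts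
    (subst (λ xs → T (All.lookup M (e i .symbol b) (ts ++ xs))) (ev-ev v r (e i .args)) t)

  reindex-complete : ∀ {Δ Γ n n'} {M : RelEnv A Γ} {e : Env Δ Γ n} {ρ c} (r : Vec (Fin n') n) {v} →
    ev v r ≡ c → EnvComplete M e c ρ → EnvComplete M (reindex r e) v ρ
  reindex-complete {M = M} {e} r {v} refl h .complete-at i b ts s =
    subst (λ xs → T (All.lookup M (e i .symbol b) (ts ++ xs))) (sym (ev-ev v r (e i .args)))
          (h .complete-at i b ts s)

  ▸-sound : ∀ {Δ Γ n k} {M : RelEnv A Γ} {e : Env Δ Γ n} {ρ} {x : Entry Γ n k}
    {S : Vec (Univ A) n → Rel A k} →
    (∀ b c ts → T (All.lookup M (x .symbol b) (ts ++ ev c (x .args))) → signed b (T (S c ts))) →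
    EnvSound M e ρ → EnvSound M (x ▸ e) (λ c → S c ∷ ρ c)
  ▸-sound s h .sound-at (here refl) = s
  ▸-sound s h .sound-at (there i) = h .sound-at i

  ▸-complete : ∀ {Δ Γ n k} {M : RelEnv A Γ} {e : Env Δ Γ n} {ρ c} {x : Entry Γ n k} {S : Rel A k} →
    (∀ b ts → signed b (T (S ts)) → T (All.lookup M (x .symbol b) (ts ++ ev c (x .args)))) →
    EnvComplete M e c ρ → EnvComplete M (x ▸ e) c (S ∷ ρ)
  ▸-complete s h .complete-at (here refl) = s
  ▸-complete s h .complete-at (there i) = h .complete-at i

  step-sat : ∀ {Δ v k} (φ : FLFP σ (k ∷ Δ) (k + v)) w {ρ : RelEnv A Δ} {η} S x →
             T (step A φ w ρ η S x) ⇔ fSat A (S ∷ ρ) (x ++ η) φ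
  step-sat φ w {ρ} {η} S x = mk⇔ toWitness (fromWitness {a? = fSat? A φ w (S ∷ ρ) (x ++ η)})

  lfp-stage : ∀ {Δ v n k} (φ : FLFP σ (k ∷ Δ) (k + v)) w pos (ρ : RelEnv A Δ)
    (c : Vec (Univ A) n) (r : Vec (Fin n) v) ts →
    let open Stages (step A φ w ρ (ev c r)) (step-mono A φ w pos ρ (ev c r))
    in fSat A ρ (ev c r) (lfp k φ ts) ⇔ T (stage N (ev c (ev r ts)))
  lfp-stage φ w pos ρ c r ts =
    Π-⇔ (λ R → →-cong-⇔ (Π-⇔ λ x → →-cong-⇔ (⇔-sym (step-sat φ w R x)) ⇔-refl)
                     (≡⇒⇔ (cong (T ∘ R) (sym (ev-ev c r ts)))))
    ⟫ Stages.lfp⇔stage _ (step-mono A φ w pos ρ (ev c r)) (ev c (ev r ts))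

  graph-± : ∀ {Γ n} {X : Vec (Univ A) n → Set} (X? : ∀ c → Dec (X c)) {M : RelEnv A Γ} b c → signed b (X c) →
            T (All.lookup (graph X? true ∷ graph X? false ∷ M) (± b) c)
  graph-± X? {M} b c x =
    subst (λ R → T (R c)) (sym (lookup-± A (graph X?) {M} b)) (from (graph-sat X? b c) x)

  fSat-≡ : ∀ {Δ v} (φ : FLFP σ Δ v) {ρ ρ' : RelEnv A Δ} {η η'} → ρ ≡ ρ' → η ≡ η' →
           fSat A ρ η φ ⇔ fSat A ρ' η' φ
  fSat-≡ φ refl refl = ⇔-refl

  atomic-sat : ∀ {Γ n} (l : Bool → BodyLit σ Γ n) P {M} → progSat A M (atomic l P) ⇔
    (∀ b c → litSat A M c (l b) → T (All.lookup M (P b) c))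
  atomic-sat {n = n} l P {M} =
    Bool-⇔ {X = λ b → progSat A M (rule n (l b ∷ []) (hrel (P b) (allFin n)))} λ b →
      Π-⇔ λ c → premise ⇔-refl (conclusion (atom A M (P b) c (allFin n) refl (ev-allFin c)))

  ratm-lit : ∀ {Γ v n k} b (p : k ∈ σ) ts (r : Vec (Fin n) v) {M : RelEnv A Γ} c →
             litSat A M c (patom b p (ev r ts)) ⇔ signed b (T (rel A p (ev (ev c r) ts)))
  ratm-lit b p ts r c = signed-⇔ b (≡⇒⇔ (cong (T ∘ rel A p) (ev-ev c r ts)))

  eq-lit : ∀ {Γ v n} b s t (r : Vec (Fin n) v) {M : RelEnv A Γ} c →
           litSat {σ} A M c (eatom b (lookup r s) (lookup r t))
           ⇔ signed b (lookup (ev c r) s ≡ lookup (ev c r) t)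
  eq-lit b s t r c = signed-⇔ b (≡⇒⇔ (sym (cong₂ _≡_ (lookup-map s _ r) (lookup-map t _ r))))

  rvar-lit : ∀ {Γ v n k m} (i : (k + m) ∈ Γ) ts (r : Vec (Fin n) v) (xs : Vec (Fin n) m) {M : RelEnv A Γ} c →
             litSat {σ} A M c (ratom i (ev r ts ++ xs)) ⇔ T (All.lookup M i (ev (ev c r) ts ++ ev c xs))
  rvar-lit i ts r xs {M} c = atom A M i c _ refl (ev-++ c (ev r ts) xs (ev-ev c r ts) refl)

  -- Auxiliary relations are taken to be exact. Rules then hold as soon as the relations read in
  -- bodies are not too large (`EnvSound`) and the target `P` is not too small.
  sound : ∀ {Δ Γ v n} (φ : FLFP σ Δ v) → WF φ → ∀ (r : Vec (Fin n) v) (e : Env Δ Γ n) (P : Bool → n ∈ Γ)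
    (M : RelEnv A Γ) (ρ : Vec (Univ A) n → RelEnv A Δ) → EnvSound M e ρ →
    (∀ b c → signed b (fSat A (ρ c) (ev c r) φ) → T (All.lookup M (P b) c)) →
    progSat A M (compile φ r e P)
  sound (ratm p ts) w r e P M ρ h q = from (atomic-sat (λ b → patom b p (ev r ts)) P) λ b c l →
    q b c (to (ratm-lit b p ts r {M} c) l)
  sound (eq s t) w r e P M ρ h q = from (atomic-sat (λ b → eatom b (lookup r s) (lookup r t)) P) λ b c l →
    q b c (to (eq-lit b s t r {M} c) l)
  sound (rvar i ts) w r e P M ρ h q =
    from (atomic-sat (λ b → ratom (e i .symbol b) (ev r ts ++ e i .args)) P) λ b c l →
      q b c (h .sound-at i b c _ (to (rvar-lit (e i .symbol b) ts r (e i .args) {M} c) l))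
  sound (neg φ) w r e P M ρ h q = sound φ w r e (P ∘ not) M ρ h
    (λ { true c x → q false c (signed-neg false x) ; false c x → q true c x })
  sound (and φ ψ) (w , w') r e P M ρ h q = from (junction-sat A true P _ _)
    ( graph X? , graph Y?
    , (λ c x y → q true c (to (graph-sat X? true c) x , to (graph-sat Y? true c) y))
    , (λ c x → q false c (to (graph-sat X? false c) x ∘ proj₁))
    , (λ c y → q false c (to (graph-sat Y? false c) y ∘ proj₂))
    , sound φ w r _ (up ∘ ±) _ ρ (raise-sound up² (λ _ → refl) h) (graph-± X?)
    , sound ψ w' r _ ± _ ρ (raise-sound up² (λ _ → refl) h) (graph-± Y?) )
    where
    X? = λ c → fSat? A φ w (ρ c) (ev c r)
    Y? = λ c → fSat? A ψ w' (ρ c) (ev c r)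
  sound (or φ ψ) (w , w') r e P M ρ h q = from (junction-sat A false P _ _)
    ( graph X? , graph Y?
    , (λ c x y → q false c Sum.[ to (graph-sat X? false c) x , to (graph-sat Y? false c) y ])
    , (λ c x → q true c (inj₁ (to (graph-sat X? true c) x)))
    , (λ c y → q true c (inj₂ (to (graph-sat Y? true c) y)))
    , sound φ w r _ (up ∘ ±) _ ρ (raise-sound up² (λ _ → refl) h) (graph-± X?)
    , sound ψ w' r _ ± _ ρ (raise-sound up² (λ _ → refl) h) (graph-± Y?) )
    where
    X? = λ c → fSat? A φ w (ρ c) (ev c r)
    Y? = λ c → fSat? A ψ w' (ρ c) (ev c r)
  sound {n = n} (all φ) w r e P M ρ h q = from (quantifier-sat A true P _)
    ( graph X?
    , (λ c x → q true c λ a → to (X-at (a ∷ᵥ []ᵥ) c) (to (graph-sat X? true (a ∷ᵥ c)) (x (a ∷ᵥ []ᵥ))))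
    , (λ { (a ∷ᵥ []ᵥ) c x → q false c λ y →
             to (graph-sat X? false (a ∷ᵥ c)) x (from (X-at (a ∷ᵥ []ᵥ) c) (y a)) })
    , sound φ w (lift 1 r) _ ± _ (λ v → ρ (ev v (shift 1 (allFin n))))
        (raise-sound up (λ _ → refl) (reindex-sound _ h)) (graph-± X?) )
    where
    X? = λ v → fSat? A φ w (ρ (ev v (shift 1 (allFin n)))) (ev v (lift 1 r))
    X-at : ∀ x c → _ ⇔ fSat A (ρ c) (x ++ ev c r) φ
    X-at x c = fSat-≡ φ (cong ρ (ev-rests x c)) (ev-lift x c r refl)
  sound {n = n} (ex φ) w r e P M ρ h q = from (quantifier-sat A false P _)
    ( graph X?
    , (λ c x → q false c λ (a , y) →
         to (graph-sat X? false (a ∷ᵥ c)) (x (a ∷ᵥ []ᵥ)) (from (X-at (a ∷ᵥ []ᵥ) c) y))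
    , (λ { (a ∷ᵥ []ᵥ) c x → q true c
             (a , to (X-at (a ∷ᵥ []ᵥ) c) (to (graph-sat X? true (a ∷ᵥ c)) x)) })
    , sound φ w (lift 1 r) _ ± _ (λ v → ρ (ev v (shift 1 (allFin n))))
        (raise-sound up (λ _ → refl) (reindex-sound _ h)) (graph-± X?) )
    where
    X? = λ v → fSat? A φ w (ρ (ev v (shift 1 (allFin n)))) (ev v (lift 1 r))
    X-at : ∀ x c → _ ⇔ fSat A (ρ c) (x ++ ev c r) φ
    X-at x c = fSat-≡ φ (cong ρ (ev-rests x c)) (ev-lift x c r refl)
  sound {n = n} (lfp k φ ts) (pos , w) r e P M ρ h q = from (fixpoint-sat A k (ev r ts) P _ _)
    ( (λ b _ → not b) , graph L? , graph I? , graph W?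
    , (λ _ → tt)
    , sound φ w rI _ (up ∘ ±) _ ρI
        (▸-sound (λ { true _ _ () ; false _ _ _ () })
          (raise-sound up⁴ (λ _ → refl) (reindex-sound {e = e} {ρ} cI h)))
        (graph-± I?)
    , sound φ w rW _ ± _ ρW
        (▸-sound {S = λ v → upTo (ev v yW) (ev v cW)} L-sound
          (raise-sound up⁴ (λ _ → refl) (reindex-sound {e = e} {ρ} cW h)))
        (graph-± W?)
    -- Stage 0 is empty, so every element of F(∅) is new and names stage 1.
    , (λ b x z c iz ix → from (L-at b x z c ⟫ signed-⇔ b (new-level 0 z c (to (I-at true z c) iz) (λ ()) x))
         (to (I-at b x c) ix))
    , (λ b x z y c lz wz wx → from
         (L-at b x z c ⟫ signed-⇔ b (new-level (S.level c y) z c (to (W-at true z y c) wz) (to (L-at false z y c) lz) x))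
         (to (W-at b x y c) wx))
    , (λ y c l → q true c (from (lfp-at c)
         (S.stage⊑N c (S.level c y) _ (to (L-at true _ y c) l))))
    -- F maps the empty relation to itself, which is thus a prefixed point, so the fixed point is
    -- empty.
    , (λ c i → q false c λ t → ⊥-elim
         (S.stage⊑prefixed c {λ _ → false} (λ x s → ⊥-elim (to (I-at false x c) (i x) s))
            (S.N c) _ (to (lfp-at c) t)))
    -- The premise makes the stage of `y` a prefixed point. It contains the fixed point, yet omits
    -- the tuple in question.
    , (λ y c f l → q false c λ t → to (L-at false _ y c) l
         (S.stage⊑prefixed c (λ x s → Sum.[ (λ wx → ⊥-elim (to (W-at false x y c) wx s))
                                               , to (L-at true x y c) ] (f x))
            (S.N c) _ (to (lfp-at c) t))) )
    where
    module S (c : Vec (Univ A) n) = Stages (step A φ w (ρ c) (ev c r)) (step-mono A φ w pos (ρ c) (ev c r))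

    upTo : Vec (Univ A) k → Vec (Univ A) n → Rel A k
    upTo y c = S.stage c (S.level c y)

    cI = shift k (allFin n)
    cW = shift k (shift k (allFin n))
    xW = firsts k (k + n)
    yW = shift k (firsts k n)
    rI = lift k r
    rW = firsts k (k + n) ++ shift k (shift k r)

    ρI : Vec (Univ A) (k + n) → RelEnv A _
    ρI v = (λ _ → false) ∷ ρ (ev v cI)
    ρW : Vec (Univ A) (k + (k + n)) → RelEnv A _
    ρW v = upTo (ev v yW) (ev v cW) ∷ ρ (ev v cW)

    I? = λ v → fSat? A φ w (ρI v) (ev v rI)
    W? = λ v → fSat? A φ w (ρW v) (ev v rW)
    L? = λ v → T? (upTo (ev v yW) (ev v cW) (ev v xW))

    ev-yW : ∀ (x y : Vec (Univ A) k) (c : Vec (Univ A) n) → ev (x ++ (y ++ c)) yW ≡ y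
    ev-yW x y c = trans (ev-shift x _ _) (ev-firsts y c)
    ev-cW : ∀ (x y : Vec (Univ A) k) (c : Vec (Univ A) n) → ev (x ++ (y ++ c)) cW ≡ c
    ev-cW x y c = trans (ev-shift x _ _) (ev-rests y c)

    upTo-≡ : ∀ {y y' c c' x x'} → y ≡ y' → c ≡ c' → x ≡ x' → T (upTo y c x) ⇔ T (upTo y' c' x')
    upTo-≡ refl refl refl = ⇔-refl

    I-at : ∀ b x c → T (graph I? b (x ++ c)) ⇔ signed b (T (S.stage c 1 x))
    I-at b x c = graph-sat I? b (x ++ c) ⟫ signed-⇔ b
      (fSat-≡ φ (cong (λ c → (λ _ → false) ∷ ρ c) (ev-rests x c)) (ev-lift x c r refl)
       ⟫ ⇔-sym (step-sat φ w _ x))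

    L-at : ∀ b x y c → T (graph L? b (x ++ (y ++ c))) ⇔ signed b (T (upTo y c x))
    L-at b x y c = graph-sat L? b (x ++ (y ++ c)) ⟫ signed-⇔ b
      (upTo-≡ (ev-yW x y c) (ev-cW x y c) (ev-firsts x (y ++ c)))

    W-at : ∀ b x y c → T (graph W? b (x ++ (y ++ c))) ⇔ signed b (T (S.stage c (suc (S.level c y)) x))
    W-at b x y c = graph-sat W? b (x ++ (y ++ c)) ⟫ signed-⇔ b
      (fSat-≡ φ (cong₂ (λ y c → upTo y c ∷ ρ c) (ev-yW x y c) (ev-cW x y c))
                (ev-++ (x ++ (y ++ c)) _ _ (ev-firsts x (y ++ c)) (trans (ev-shift x _ _) (ev-shift y c r)))
       ⟫ ⇔-sym (step-sat φ w _ x))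

    new-level : ∀ m z c → T (S.stage c (suc m) z) → ¬ T (S.stage c m z) → ∀ x →
                T (upTo z c x) ⇔ T (S.stage c (suc m) x)
    new-level m z c s ¬s x = ≡⇒⇔ (cong (λ j → T (S.stage c j x)) (S.level-new c m z s ¬s))

    lfp-at : ∀ c → fSat A (ρ c) (ev c r) (lfp k φ ts) ⇔ T (S.stage c (S.N c) (ev c (ev r ts)))
    lfp-at c = lfp-stage φ w pos (ρ c) c r ts

    L-sound : ∀ b v ts → T (All.lookup (graph W? true ∷ graph W? false ∷ graph I? true ∷ graph I? false
                ∷ graph L? true ∷ graph L? false ∷ (λ _ → false) ∷ (λ _ → true) ∷ M) (up² (± b))
                (ts ++ ev v (shift k (allFin (k + n))))) → signed b (T (upTo (ev v yW) (ev v cW) ts))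
    L-sound b v ts t = to (graph-sat L? b (ts ++ u) ⟫ signed-⇔ b (upTo-≡
        (trans (ev-shift ts u _) (sym (ev-tail v (firsts k n))))
        (trans (ev-shift ts u _) (sym (ev-tail v (shift k (allFin n)))))
        (ev-firsts ts u)))
      (subst (λ R → T (R (ts ++ u))) (lookup-± A (graph L?) {(λ _ → false) ∷ (λ _ → true) ∷ M} b) t)
      where
      u = ev v (shift k (allFin (k + n)))

-- Every model of the compiled program contains the truth values

open EnvComplete

module _ {σ : Sig} (A : Structure σ) where

  lookup-±⁻ : ∀ {Γ n} (R : Bool → Rel A n) {M : RelEnv A Γ} b c →
              T (All.lookup (R true ∷ R false ∷ M) (± b) c) → T (R b c)
  lookup-±⁻ R {M} b c = subst (λ S → T (S c)) (lookup-± A R {M} b)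

  junction-complete : ∀ {Γ n} b (P : Bool → n ∈ Γ) D E {M} c {X Y : Set} →
    (∀ Q R → let M' = R true ∷ R false ∷ Q true ∷ Q false ∷ M in
       progSat A M' D → ∀ b → signed b X → T (All.lookup M' (up (± b)) c)) →
    (∀ Q R → let M' = R true ∷ R false ∷ Q true ∷ Q false ∷ M in
       progSat A M' E → ∀ b → signed b Y → T (All.lookup M' (± b) c)) →
    progSat A M (junction {σ} b P D E) →
    (signed b X → signed b Y → T (All.lookup M (P b) c))
    × (signed (not b) X ⊎ signed (not b) Y → T (All.lookup M (P (not b)) c))
  junction-complete {n = n} b P D E {M} c {X} {Y} f g d = go (to (junction-sat A b P D E) d)
    where
    go : (Σ (Bool → Rel A n) λ Q → Σ (Bool → Rel A n) λ R →
          let M' = R true ∷ R false ∷ Q true ∷ Q false ∷ M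
          in JunctionSat A b P M Q R (progSat A M' D) (progSat A M' E)) →
         (signed b X → signed b Y → T (All.lookup M (P b) c))
         × (signed (not b) X ⊎ signed (not b) Y → T (All.lookup M (P (not b)) c))
    go (Q , R , joint , left , right , D' , E') =
      (λ x y → joint c (inQ b x) (inR b y)) , Sum.[ left c ∘ inQ (not b) , right c ∘ inR (not b) ]
      where
      inQ : ∀ b → signed b X → T (Q b c)
      inQ b x = lookup-±⁻ Q {M} b c (f Q R D' b x)
      inR : ∀ b → signed b Y → T (R b c)
      inR b y = lookup-±⁻ R {Q true ∷ Q false ∷ M} b c (g Q R E' b y)

  quantifier-complete : ∀ {Γ n} b (P : Bool → n ∈ Γ) D {M} c {X : Vec (Univ A) 1 → Set} →
    (∀ Q → let M' = Q true ∷ Q false ∷ M in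
       progSat A M' D → ∀ b x → signed b (X x) → T (All.lookup M' (± b) (x ++ c))) →
    progSat A M (quantifier {σ} b P D) →
    ((∀ a → signed b (X (a ∷ᵥ []ᵥ))) → T (All.lookup M (P b) c))
    × (∀ a → signed (not b) (X (a ∷ᵥ []ᵥ)) → T (All.lookup M (P (not b)) c))
  quantifier-complete b P D {M} c {X} f d =
    let Q , every , some , D' = to (quantifier-sat A b P D) d
        inQ : ∀ b x → signed b (X x) → T (Q b (x ++ c))
        inQ b x s = lookup-±⁻ Q {M} b (x ++ c) (f Q D' b x s)
    in (λ h → every c λ { x@(a ∷ᵥ []ᵥ) → inQ b x (h a) }) , (λ a → some _ c ∘ inQ (not b) (a ∷ᵥ []ᵥ))

  module _ {k : ℕ} (F : Rel A k → Rel A k) (F-mono : ∀ {S S'} → S ⊆ᵣ S' → F S ⊆ᵣ F S') where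

    open Stages F F-mono hiding (Rel)

    -- By induction on stages (`inL`), a model contains each nonempty stage and its complement under
    -- every new element as name. Membership is then read off at the stage a tuple enters,
    -- non-membership at the last stage that grows.
    fixpoint-complete : ∀ {Γ n} (ts : Vec (Fin n) k) (P : Bool → n ∈ Γ) D E {M} c →
      (∀ Z L I W → let M' = W true ∷ W false ∷ I true ∷ I false ∷ L true ∷ L false ∷ Z true ∷ Z false ∷ M in
         (∀ (x : Vec (Univ A) k) → T (Z false (x ++ []ᵥ))) → progSat A M' D →
         ∀ b x → signed b (T (stage 1 x)) → T (All.lookup M' (up (± b)) (x ++ c))) →
      (∀ Z L I W → let M' = W true ∷ W false ∷ I true ∷ I false ∷ L true ∷ L false ∷ Z true ∷ Z false ∷ M in
         progSat A M' E → ∀ S y →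
         (∀ b x → signed b (T (S x)) → T (All.lookup M' (up² (± b)) (x ++ (y ++ c)))) →
         ∀ b x → signed b (T (F S x)) → T (All.lookup M' (± b) (x ++ (y ++ c)))) →
      progSat A M (fixpoint {σ} k ts P D E) →
      ∀ b → signed b (T (stage N (ev c ts))) → T (All.lookup M (P b) c)
    fixpoint-complete {n = n} ts P D E {M} c f g d = go (to (fixpoint-sat A k ts P D E) d)
      where
      go : (Σ (Bool → Rel A (k + 0)) λ Z → Σ (Bool → Rel A (k + (k + n))) λ L →
            Σ (Bool → Rel A (k + n)) λ I → Σ (Bool → Rel A (k + (k + n))) λ W →
            let M' = W true ∷ W false ∷ I true ∷ I false ∷ L true ∷ L false ∷ Z true ∷ Z false ∷ M
            in FixpointSat A k ts P M Z L I W (progSat A M' D) (progSat A M' E)) →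
           ∀ b → signed b (T (stage N (ev c ts))) → T (All.lookup M (P b) c)
      go (Z , L , I , W , empty , D' , E' , initial , successor , accept , reject∅ , reject) = decide
        where
        ML = Z true ∷ Z false ∷ M
        MI = L true ∷ L false ∷ ML
        MW = I true ∷ I false ∷ MI

        inI : ∀ b x → signed b (T (stage 1 x)) → T (I b (x ++ c))
        inI b x s = lookup-±⁻ I {MI} b (x ++ c) (f Z L I W empty D' b x s)

        inW : ∀ S y → (∀ b x → signed b (T (S x)) → T (L b (x ++ (y ++ c)))) →
              ∀ b x → signed b (T (F S x)) → T (W b (x ++ (y ++ c)))
        inW S y l b x s = lookup-±⁻ W {MW} b (x ++ (y ++ c)) (g Z L I W E' S y
          (λ b x s → subst (λ R → T (R (x ++ (y ++ c)))) (sym (lookup-± A L {ML} b)) (l b x s)) b x s)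

        inL : ∀ m z → T (stage (suc m) z) → ¬ T (stage m z) →
              ∀ b x → signed b (T (stage (suc m) x)) → T (L b (x ++ (z ++ c)))
        inL zero z s _ b x t = initial b x z c (inI true z s) (inI b x t)
        inL (suc m) z s ¬s b x t =
          -- If stage `m + 1` added nothing to stage `m`, by monotonicity the next step would add
          -- nothing either, contradicting `z`. So some `y` names stage `m + 1`, and its complement
          -- shows that `z` is new.
          let y , u , ¬u = ⋢-witness {stage (suc m)} {stage m} (λ closed → ¬s (F-mono closed z s))
          in successor b x z y c (inL m y u ¬u false z ¬s)
               (inW (stage (suc m)) y (inL m y u ¬u) true z s) (inW (stage (suc m)) y (inL m y u ¬u) b x t)

        accepting : ∀ t → (T (stage 0 t) ⊎ Σ ℕ λ m → ¬ T (stage m t) × T (stage (suc m) t)) →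
                    T (L true (t ++ (t ++ c)))
        -- Stage 0 is empty, and otherwise `t` itself names the stage it enters.
        accepting t (inj₂ (m , ¬u , u)) = inL m t u ¬u true t u

        rejecting : ¬ T (stage N (ev c ts)) → (Closed 0 ⊎ Σ ℕ λ m → ¬ Closed m × Closed (suc m)) →
                    T (All.lookup M (P false) c)
        rejecting ¬s (inj₁ closed) = reject∅ c (λ x → inI false x (closed x))
        rejecting ¬s (inj₂ (m , ¬closed , closed)) =
          -- Step `m` is the last that adds elements; any `y` new there names stage `m + 1`, which
          -- is closed.
          let y , u , ¬u = ⋢-witness {stage (suc m)} {stage m} ¬closed
          in reject y c (final y u ¬u) (inL m y u ¬u false (ev c ts) (¬s ∘ stage⊑N (suc m) (ev c ts)))
          where
          final : ∀ y → T (stage (suc m) y) → ¬ T (stage m y) →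
                  ∀ x → T (W false (x ++ (y ++ c))) ⊎ T (L true (x ++ (y ++ c)))
          final y u ¬u x with T? (stage (suc m) x)
          ... | yes v = inj₂ (inL m y u ¬u true x v)
          ... | no ¬v = inj₁ (inW (stage (suc m)) y (inL m y u ¬u) false x (¬v ∘ closed x))

        decide : ∀ b → signed b (T (stage N (ev c ts))) → T (All.lookup M (P b) c)
        decide true s = accept (ev c ts) c
          (accepting (ev c ts) (switch (λ m → T (stage m (ev c ts))) (λ m → T? _) N s))
        decide false ¬s = rejecting ¬s (switch Closed closed? N closed-N)

  -- Both signs go through one induction, since a negation or the complement of a stage feeds on the
  -- other sign. Classical case distinctions are available because formulas are decidable.
  complete : ∀ {Δ Γ v n} (φ : FLFP σ Δ v) → WF φ → ∀ (r : Vec (Fin n) v) (e : Env Δ Γ n) (P : Bool → n ∈ Γ)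
    (M : RelEnv A Γ) → progSat A M (compile φ r e P) →
    ∀ c (ρ : RelEnv A Δ) → EnvComplete A M e c ρ →
    ∀ b → signed b (fSat A ρ (ev c r) φ) → T (All.lookup M (P b) c)
  complete (ratm p ts) w r e P M d c ρ h b x =
    to (atomic-sat A (λ b → patom b p (ev r ts)) P) d b c (from (ratm-lit A b p ts r {M} c) x)
  complete (eq s t) w r e P M d c ρ h b x =
    to (atomic-sat A (λ b → eatom b (lookup r s) (lookup r t)) P) d b c (from (eq-lit A b s t r {M} c) x)
  complete (rvar i ts) w r e P M d c ρ h b x =
    to (atomic-sat A (λ b → ratom (e i .symbol b) (ev r ts ++ e i .args)) P) d b c
       (from (rvar-lit A (e i .symbol b) ts r (e i .args) {M} c) (h .complete-at i b _ x))
  complete (neg φ) w r e P M d c ρ h true x = complete φ w r e (P ∘ not) M d c ρ h false x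
  complete (neg φ) w r e P M d c ρ h false x =
    complete φ w r e (P ∘ not) M d c ρ h true (decidable-stable (fSat? A φ w ρ (ev c r)) x)
  complete (and φ ψ) (w , w') r e P M d c ρ h = go
    where
    junct = junction-complete true P _ _ {M} c
      (λ _ _ D → complete φ w r _ (up ∘ ±) _ D c ρ (raise-complete A up² {M} (λ _ → refl) h))
      (λ _ _ E → complete ψ w' r _ ± _ E c ρ (raise-complete A up² {M} (λ _ → refl) h)) d
    go : ∀ b → signed b (fSat A ρ (ev c r) (and φ ψ)) → T (All.lookup M (P b) c)
    go true (x , y) = proj₁ junct x y
    go false ¬xy with fSat? A φ w ρ (ev c r)
    ... | yes x = proj₂ junct (inj₂ λ y → ¬xy (x , y))
    ... | no ¬x = proj₂ junct (inj₁ ¬x)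
  complete (or φ ψ) (w , w') r e P M d c ρ h = go
    where
    junct = junction-complete false P _ _ {M} c
      (λ _ _ D → complete φ w r _ (up ∘ ±) _ D c ρ (raise-complete A up² {M} (λ _ → refl) h))
      (λ _ _ E → complete ψ w' r _ ± _ E c ρ (raise-complete A up² {M} (λ _ → refl) h)) d
    go : ∀ b → signed b (fSat A ρ (ev c r) (or φ ψ)) → T (All.lookup M (P b) c)
    go true xy = proj₂ junct xy
    go false ¬xy = proj₁ junct (¬xy ∘ inj₁) (¬xy ∘ inj₂)
  complete {n = n} (all φ) w r e P M d c ρ h = go
    where
    quant = quantifier-complete true P _ {M} c {λ x → fSat A ρ (x ++ ev c r) φ}
      (λ _ D b x s → complete φ w (lift 1 r) _ ± _ D (x ++ c) ρ
         (raise-complete A up {M} (λ _ → refl) (reindex-complete A _ (ev-rests x c) h)) b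
         (to (signed-⇔ b (fSat-≡ A φ refl (sym (ev-lift x c r refl)))) s)) d
    go : ∀ b → signed b (fSat A ρ (ev c r) (all φ)) → T (All.lookup M (P b) c)
    go true f = proj₁ quant f
    go false ¬f with any? (λ a → ¬? (fSat? A φ w ρ (a ∷ᵥ ev c r)))
    ... | yes (a , ¬x) = proj₂ quant a ¬x
    ... | no none = ⊥-elim (¬f λ a → decidable-stable (fSat? A φ w ρ (a ∷ᵥ ev c r)) λ ¬x → none (a , ¬x))
  complete {n = n} (ex φ) w r e P M d c ρ h = go
    where
    quant = quantifier-complete false P _ {M} c {λ x → fSat A ρ (x ++ ev c r) φ}
      (λ _ D b x s → complete φ w (lift 1 r) _ ± _ D (x ++ c) ρ
         (raise-complete A up {M} (λ _ → refl) (reindex-complete A _ (ev-rests x c) h)) b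
         (to (signed-⇔ b (fSat-≡ A φ refl (sym (ev-lift x c r refl)))) s)) d
    go : ∀ b → signed b (fSat A ρ (ev c r) (ex φ)) → T (All.lookup M (P b) c)
    go true (a , x) = proj₂ quant a x
    go false ¬x = proj₁ quant (λ a x → ¬x (a , x))
  complete {n = n} (lfp k φ ts) (pos , w) r e P M d c ρ h b s =
    fixpoint-complete (step A φ w ρ (ev c r)) (step-mono A φ w pos ρ (ev c r)) (ev r ts) P _ _ {M} c inI inW d b
      (to (signed-⇔ b (lfp-stage A φ w pos ρ c r ts)) s)
    where
    inI = λ Z L I W empty D b x s →
      complete φ w (lift k r) _ (up ∘ ±) _ D (x ++ c) ((λ _ → false) ∷ ρ)
        (▸-complete A (λ { true _ () ; false xs _ → empty xs })
          (raise-complete A up⁴ {M} (λ _ → refl) (reindex-complete A _ (ev-rests x c) h))) b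
        (to (signed-⇔ b (step-sat A φ w _ x ⟫ fSat-≡ A φ refl (sym (ev-lift x c r refl)))) s)

    inW = λ Z L I W E S y l b x s →
      let M' = W true ∷ W false ∷ I true ∷ I false ∷ L true ∷ L false ∷ Z true ∷ Z false ∷ M in
      complete φ w (firsts k (k + n) ++ shift k (shift k r)) _ ± _ E (x ++ (y ++ c)) (S ∷ ρ)
        (▸-complete A
          (λ b xs s → subst (λ v → T (All.lookup M' (up² (± b)) (xs ++ v))) (sym (ev-rests x (y ++ c))) (l b xs s))
          (raise-complete A up⁴ {M} (λ _ → refl)
            (reindex-complete A _ (trans (ev-shift x _ _) (ev-rests y c)) h))) b
        (to (signed-⇔ b (step-sat A φ w S x ⟫ fSat-≡ A φ refl (sym
          (ev-++ (x ++ (y ++ c)) (firsts k (k + n)) _ (ev-firsts x _)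
            (trans (ev-shift x _ _) (ev-shift y c r)))))) s)

lfp⇒horn : ∀ {σ} (ψ : FOLFPSentence σ) → Σ (SOHornSentence σ) λ θ →
           (A : Structure σ) → (A ⊨LFP ψ) ⇔ (A ⊨SO θ)
lfp⇒horn {σ} (φ , w) = prenex program , λ A → decided A ⟫ ⇔-sym (prenex-sat A program)
  where
  program : Program σ []
  -- Only the negative relation is tested: by `complete` it holds in every model whenever the
  -- sentence fails.
  program = ∃± 0 (compile φ []ᵥ (λ ()) ± ∧ rule 0 (ratom (± false) []ᵥ ∷ []) hbot)

  decided : ∀ A → fSat A [] []ᵥ φ ⇔ progSat A [] program
  decided A = mk⇔ models proves
    where
    φ? : (c : Vec (Univ A) 0) → Dec (fSat A [] []ᵥ φ)
    φ? _ = fSat? A φ w [] []ᵥ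

    models : fSat A [] []ᵥ φ → progSat A [] program
    models x = graph φ? false , graph φ? true
      , sound A φ w []ᵥ (λ ()) ± _ (λ _ → []) (record { sound-at = λ () }) (graph-± A φ?)
      , λ { c (p ∷ []) → to (graph-sat φ? false []ᵥ) p x }

    proves : progSat A [] program → fSat A [] []ᵥ φ
    proves (R⁻ , R⁺ , D , consistent) = decidable-stable (φ? []ᵥ) λ ¬x →
      consistent []ᵥ
        (complete A φ w []ᵥ (λ ()) ± _ D []ᵥ [] (record { complete-at = λ () }) false ¬x ∷ [])

theorem2 : (σ : Sig) →
    ((θ : SOHornSentence σ) → Σ (FOLFPSentence σ) λ ψ →
       (A : Structure σ) → (A ⊨SO θ) ⇔ (A ⊨LFP ψ))
    × ((ψ : FOLFPSentence σ) → Σ (SOHornSentence σ) λ θ →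
       (A : Structure σ) → (A ⊨LFP ψ) ⇔ (A ⊨SO θ))
theorem2 σ = horn⇒lfp , lfp⇒horn
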